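{- Let $K$ be a primitive quartic CM field whose real quadratic subfield $K_0$ has class number one, and let $\Phi$ be a CM-type of $K$. Let $\ell$ be a prime and $\mathfrak{l}\subset\mathcal{O}_{K_0}$ a prime ideal of norm $\ell$. Let $A=\mathbb{C}^2/\Phi(\Lambda)$ be an abelian surface over $\mathbb{C}$ with complex multiplication by an order $\mathcal{O}\subset K$ containing $\mathcal{O}_{K_0}$, where $\Lambda=\Lambda_1+\Lambda_2\tau$ with $\Lambda_1,\Lambda_2$ fractional ideals of $\mathcal{O}_{K_0}$ and $\tau\in K\setminus K_0$. A set of representatives of the (nontrivial) cyclic subgroups of $(\mathfrak{l}^{ -1}\Lambda)/\Lambda$, and more precisely of the isogenies on $A$ having these subgroups as kernels, is given by $$\{I_\infty\}\cup\{I_\rho : \rho\in\Lambda_1\Lambda_2^{ -1}/\mathfrak{l}\Lambda_1\Lambda_2^{ -1}\},$$ where $$I_\infty: A\to\mathbb{C}^2/\Phi(\mathfrak{l}^{ -1}\Lambda_1+\Lambda_2\tau),\ z\mapsto z,\qquad I_\rho: A\to\mathbb{C}^2/\Phi(\Lambda_1+\mathfrak{l}^{ -1}\Lambda_2(\tau+\rho)),\ z\mapsto z.$$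
   Context: A quartic CM field is primitive if it contains no imaginary quadratic subfield. A CM-type $\Phi=(\phi_1,\phi_2)$ is a pair of non-complex-conjugate embeddings $K\to\mathbb{C}$; $\Phi(x)=(\phi_1(x),\phi_2(x))\in\mathbb{C}^2$ for $x\in K$. Sums such as $\Lambda_1+\Lambda_2\tau$ denote the $\mathcal{O}_{K_0}$-submodule of $K$ they generate. The maps $z\mapsto z$ are the isogenies induced by the identity of $\mathbb{C}^2$; their kernels are viewed inside $\Phi(\mathfrak{l}^{ -1}\Lambda)/\Phi(\Lambda)\subset A$. -}

module Defs where

open import Algebra.Bundles using (CommutativeRing)
open import Algebra.Bundles.Raw using (RawGroup; RawRing)
import Algebra.Definitions.RawMonoid as RawMonoidDefs
import Algebra.Definitions.RawSemiring as RawSemiringDefs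
open import Algebra.Module.Bundles using (Module)
import Algebra.Module.Construct.DirectProduct as DirectProduct
import Algebra.Module.Construct.TensorUnit as TensorUnit
open import Algebra.Module.Morphism.Structures using (module ModuleMorphisms)
open import Algebra.Morphism.Structures using (module RingMorphisms)
import Algebra.Properties.AbelianGroup as AbelianGroupProperties
import Algebra.Properties.CommutativeSemigroup as CommutativeSemigroupProperties
import Algebra.Properties.Ring as RingProperties
import Algebra.Solver.Ring.NaturalCoefficients.Default as NaturalCoefficients
open import Data.Fin.Base using (Fin; toℕ)
open import Data.Integer.Base as ℤ using (ℤ)
open import Data.Maybe.Base using (Maybe; just; nothing)
open import Data.Maybe.Relation.Binary.Pointwise using (Pointwise)
open import Data.Nat.Base as ℕ using (ℕ)
import Data.Nat.Properties as ℕ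
open import Data.Product.Base using (Σ; Σ-syntax; ∃; ∃-syntax; _×_; _,_; proj₁; proj₂)
open import Data.Rational.Base as ℚ using (ℚ; 0ℚ; 1ℚ; ½)
import Data.Rational.Properties as ℚ
open import Data.Sum.Base using (_⊎_)
open import Function.Definitions using (Congruent; Bijective; Surjective)
open import Level using (0ℓ)
open import Relation.Binary.Core using (Rel)
open import Relation.Binary.PropositionalEquality as ≡ using (_≡_; cong; subst)
open import Relation.Nullary.Negation using (¬_)
open import Relation.Unary using (Pred; _∈_; _∉_; _⊆_; _≐_; U)
open import Relation.Binary.Definitions using (_Respects_)

private
  module Identities (R : CommutativeRing 0ℓ 0ℓ) where
    open CommutativeRing R
    open AbelianGroupProperties +-abelianGroup public
      using () renaming (⁻¹-anti-homo‿- to -‿swap)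
    open AbelianGroupProperties +-abelianGroup
      using (\\-leftDividesʳ; //-rightDividesˡ; ε⁻¹≈ε; ⁻¹-∙-comm)
    open CommutativeSemigroupProperties +-commutativeSemigroup using (interchange)
    open RingProperties ring using (-1*x≈-x; -‿distribʳ-*)
    open NaturalCoefficients commutativeSemiring

    telescope : ∀ a b c → (a - b) + (b - c) ≈ a - c
    telescope a b c = trans (+-assoc a (- b) (b - c)) (+-congˡ (\\-leftDividesʳ b (- c)))

    restore : ∀ a b → (a - b) + b ≈ a
    restore a b = //-rightDividesˡ b a

    +-difference : ∀ a b c d → (a - b) + (c - d) ≈ (a + c) - (b + d)
    +-difference a b c d = trans (interchange a (- b) c (- d)) (+-congˡ (⁻¹-∙-comm b d))

    *-difference : ∀ a b c d → a * (c - d) + d * (a - b) ≈ a * c - b * d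
    *-difference a b c d = trans
      (+-cong (trans (distribˡ a c (- d)) (+-congˡ (sym (-‿distribʳ-* a d))))
              (trans (distribˡ d a (- b))
                     (+-cong (*-comm d a) (trans (sym (-‿distribʳ-* d b)) (-‿cong (*-comm d b))))))
      (telescope (a * c) (a * d) (b * d))

    private
      neg : ∀ x → - x ≈ - 1# * x
      neg x = sym (-1*x≈-x x)

    assoc-re : ∀ a b c d e f →
      (a * c - b * d) * e - (a * d + b * c) * f ≈ a * (c * e - d * f) - b * (c * f + d * e)
    assoc-re a b c d e f = trans
      (+-cong (*-congʳ (+-congˡ (neg _))) (neg _))
      (trans
        (solve 7 (λ m a b c d e f →
          (a :* c :+ m :* (b :* d)) :* e :+ m :* ((a :* d :+ b :* c) :* f) :=
          a :* (c :* e :+ m :* (d :* f)) :+ m :* (b :* (c :* f :+ d :* e)))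
          refl (- 1#) a b c d e f)
        (sym (+-cong (*-congˡ (+-congˡ (neg _))) (neg _))))

    assoc-im : ∀ a b c d e f →
      (a * c - b * d) * f + (a * d + b * c) * e ≈ a * (c * f + d * e) + b * (c * e - d * f)
    assoc-im a b c d e f = trans
      (+-congʳ (*-congʳ (+-congˡ (neg _))))
      (trans
        (solve 7 (λ m a b c d e f →
          (a :* c :+ m :* (b :* d)) :* f :+ (a :* d :+ b :* c) :* e :=
          a :* (c :* f :+ d :* e) :+ b :* (c :* e :+ m :* (d :* f)))
          refl (- 1#) a b c d e f)
        (sym (+-congˡ (*-congˡ (+-congˡ (neg _))))))

    identity-re : ∀ a b → 1# * a - 0# * b ≈ a
    identity-re a b = trans
      (+-cong (*-identityˡ a) (trans (-‿cong (zeroˡ b)) ε⁻¹≈ε)) (+-identityʳ a)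

    identity-im : ∀ a b → 1# * b + 0# * a ≈ b
    identity-im a b = trans (+-cong (*-identityˡ b) (zeroˡ a)) (+-identityʳ b)

    distrib-re : ∀ a b c d e f →
      a * (c + e) - b * (d + f) ≈ (a * c - b * d) + (a * e - b * f)
    distrib-re a b c d e f = trans
      (+-cong (distribˡ a c e) (-‿cong (distribˡ b d f)))
      (sym (+-difference (a * c) (b * d) (a * e) (b * f)))

    distrib-im : ∀ a b c d e f →
      a * (d + f) + b * (c + e) ≈ (a * d + b * c) + (a * f + b * e)
    distrib-im a b c d e f = trans
      (+-cong (distribˡ a d f) (distribˡ b c e)) (interchange _ _ _ _)

    comm-re : ∀ a b c d → a * c - b * d ≈ c * a - d * b
    comm-re a b c d = +-cong (*-comm a c) (-‿cong (*-comm b d))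

    comm-im : ∀ a b c d → a * d + b * c ≈ c * b + d * a
    comm-im a b c d = trans (+-cong (*-comm a d) (*-comm b c)) (+-comm _ _)

infix 4 _~_

-- x m - y n becomes arbitrarily small as m and n grow, independently of
-- each other.  Thus x ~ x says that x is a Cauchy sequence, and for Cauchy
-- sequences x ~ y says that x - y is a null sequence: ℝ is the quotient of
-- the Cauchy sequences of rationals by the null sequences.
_~_ : Rel (ℕ → ℚ) 0ℓ
x ~ y = ∀ ε → 0ℚ ℚ.< ε →
  ∃[ N ] (∀ {m n} → N ℕ.≤ m → N ℕ.≤ n → ℚ.∣ x m ℚ.- y n ∣ ℚ.< ε)

private
  module ℚ-identities = Identities ℚ.+-*-commutativeRing

  half>0 : ∀ {ε} → 0ℚ ℚ.< ε → 0ℚ ℚ.< ½ ℚ.* ε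
  half>0 {ε} 0<ε = ℚ.positive⁻¹ _
    {{ℚ.pos*pos⇒pos ½ ε {{ℚ.positive 0<ε}}}}

  half+half : ∀ ε → ½ ℚ.* ε ℚ.+ ½ ℚ.* ε ≡ ε
  half+half ε = ≡.trans (≡.sym (ℚ.*-distribʳ-+ ε ½ ½)) (ℚ.*-identityˡ ε)

  triangle : ∀ {u v ε w} → ℚ.∣ u ∣ ℚ.< ½ ℚ.* ε → ℚ.∣ v ∣ ℚ.< ½ ℚ.* ε →
    u ℚ.+ v ≡ w → ℚ.∣ w ∣ ℚ.< ε
  triangle {u} {v} {ε} p q ≡.refl = ℚ.≤-<-trans (ℚ.∣p+q∣≤∣p∣+∣q∣ u v)
    (subst (_ ℚ.<_) (half+half ε) (ℚ.+-mono-< p q))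

  product : ∀ {u v D δ} → 0ℚ ℚ.< δ → ℚ.∣ u ∣ ℚ.< D → ℚ.∣ v ∣ ℚ.< δ →
    ℚ.∣ u ℚ.* v ∣ ℚ.< D ℚ.* δ
  product {u} {v} {D} {δ} 0<δ p q =
    subst (ℚ._< D ℚ.* δ) (≡.sym (ℚ.∣p*q∣≡∣p∣*∣q∣ u v))
      (ℚ.≤-<-trans
        (ℚ.*-monoˡ-≤-nonNeg ℚ.∣ u ∣ {{ℚ.∣-∣-nonNeg u}} (ℚ.<⇒≤ q))
        (ℚ.*-monoˡ-<-pos δ {{ℚ.positive 0<δ}} p))

  scale : ∀ {D ε} → 0ℚ ℚ.< D → 0ℚ ℚ.< ε →
    ∃[ δ ] (0ℚ ℚ.< δ × D ℚ.* δ ≡ ε)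
  scale {D} {ε} 0<D 0<ε = D⁻¹ ℚ.* ε
    , ℚ.positive⁻¹ _ {{ℚ.pos*pos⇒pos D⁻¹ {{ℚ.1/pos⇒pos D}} ε {{ℚ.positive 0<ε}}}}
    , ≡.trans (≡.sym (ℚ.*-assoc D D⁻¹ ε))
        (≡.trans (cong (ℚ._* ε) (ℚ.*-inverseʳ D)) (ℚ.*-identityˡ ε))
    where
    instance
      D-pos = ℚ.positive 0<D
      D-nonZero = ℚ.pos⇒nonZero D
    D⁻¹ = ℚ.1/ D

  ≤-maxˡ : ∀ {a b n} → a ℕ.⊔ b ℕ.≤ n → a ℕ.≤ n
  ≤-maxˡ = ℕ.m⊔n≤o⇒m≤o _ _

  ≤-maxʳ : ∀ {a b n} → a ℕ.⊔ b ℕ.≤ n → b ℕ.≤ n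
  ≤-maxʳ = ℕ.m⊔n≤o⇒n≤o _ _

  ~-sym : ∀ {x y} → x ~ y → y ~ x
  ~-sym {x} {y} p ε 0<ε with N , h ← p ε 0<ε = N , λ {m} {n} a b →
    subst (ℚ._< _) (≡.trans (≡.sym (ℚ.∣-p∣≡∣p∣ _)) (cong ℚ.∣_∣ (ℚ-identities.-‿swap (x n) (y m)))) (h b a)

  ~-trans : ∀ {x y z} → x ~ y → y ~ z → x ~ z
  ~-trans {x} {y} {z} p q ε 0<ε
    with M , h ← p (½ ℚ.* ε) (half>0 0<ε) | N , k ← q (½ ℚ.* ε) (half>0 0<ε) =
    M ℕ.⊔ N , λ {m} {n} a b →
      triangle (h {m} {M ℕ.⊔ N} (≤-maxˡ {M} a) (ℕ.m≤m⊔n M N))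
               (k {M ℕ.⊔ N} {n} (ℕ.m≤n⊔m M N) (≤-maxʳ {M} b))
               (ℚ-identities.telescope (x m) (y (M ℕ.⊔ N)) (z n))

  ~-const : ∀ q → (λ _ → q) ~ (λ _ → q)
  ~-const q ε 0<ε = 0 , λ _ _ →
    subst (λ r → ℚ.∣ r ∣ ℚ.< ε) (≡.sym (ℚ.+-inverseʳ q)) 0<ε

  ~-+ : ∀ {x x′ y y′} → x ~ x′ → y ~ y′ →
    (λ n → x n ℚ.+ y n) ~ (λ n → x′ n ℚ.+ y′ n)
  ~-+ {x} {x′} {y} {y′} p q ε 0<ε
    with M , h ← p (½ ℚ.* ε) (half>0 0<ε) | N , k ← q (½ ℚ.* ε) (half>0 0<ε) =
    M ℕ.⊔ N , λ {m} {n} a b →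
      triangle (h (≤-maxˡ {M} a) (≤-maxˡ {M} b)) (k (≤-maxʳ {M} a) (≤-maxʳ {M} b))
        (ℚ-identities.+-difference (x m) (x′ n) (y m) (y′ n))

  ~-neg : ∀ {x x′} → x ~ x′ → (λ n → ℚ.- x n) ~ (λ n → ℚ.- x′ n)
  ~-neg {x} {x′} p ε 0<ε with N , h ← p ε 0<ε = N , λ {m} {n} a b →
    subst (ℚ._< _) (≡.trans (≡.sym (ℚ.∣-p∣≡∣p∣ _)) (cong ℚ.∣_∣ (ℚ.neg-distrib-+ (x m) (ℚ.- x′ n))))
      (h a b)

  ~-bounded : ∀ {x x′} → x ~ x′ →
    ∃[ B ] (0ℚ ℚ.< B × ∃[ N ] (∀ {m} → N ℕ.≤ m → ℚ.∣ x m ∣ ℚ.< B))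
  ~-bounded {x} {x′} p with N , h ← p 1ℚ (ℚ.positive⁻¹ 1ℚ) =
      1ℚ ℚ.+ ℚ.∣ x′ N ∣
    , ℚ.+-mono-<-≤ {0ℚ} {1ℚ} {0ℚ} {ℚ.∣ x′ N ∣} (ℚ.positive⁻¹ 1ℚ)
        (ℚ.nonNegative⁻¹ ℚ.∣ x′ N ∣ {{ℚ.∣-∣-nonNeg (x′ N)}})
    , N
    , λ {m} a → ℚ.≤-<-trans
        (subst (λ r → ℚ.∣ r ∣ ℚ.≤ ℚ.∣ x m ℚ.- x′ N ∣ ℚ.+ ℚ.∣ x′ N ∣) (ℚ-identities.restore (x m) (x′ N))
          (ℚ.∣p+q∣≤∣p∣+∣q∣ (x m ℚ.- x′ N) (x′ N)))
        (ℚ.+-monoˡ-< ℚ.∣ x′ N ∣ (h a ℕ.≤-refl))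

  ~-* : ∀ {x x′ y y′} → x ~ x′ → y ~ y′ →
    (λ n → x n ℚ.* y n) ~ (λ n → x′ n ℚ.* y′ n)
  ~-* {x} {x′} {y} {y′} p q ε 0<ε =
    let B , 0<B , K , u = ~-bounded {x} {x′} p
        C , 0<C , L , v = ~-bounded {y′} {y} (~-sym {y} {y′} q)
        δ , 0<δ , Bδ    = scale {B} 0<B (half>0 0<ε)
        η , 0<η , Cη    = scale {C} 0<C (half>0 0<ε)
        M , h           = p η 0<η
        N , k           = q δ 0<δ
    in (K ℕ.⊔ L) ℕ.⊔ (M ℕ.⊔ N) , λ {m} {n} a b →
      let a₁ = ≤-maxˡ {K ℕ.⊔ L} a ; a₂ = ≤-maxʳ {K ℕ.⊔ L} a
          b₁ = ≤-maxˡ {K ℕ.⊔ L} b ; b₂ = ≤-maxʳ {K ℕ.⊔ L} b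
      in *-close {x m} {x′ n} {y m} {y′ n} 0<δ Bδ 0<η Cη
           (u (≤-maxˡ {K} a₁)) (v (≤-maxʳ {K} b₁))
           (h (≤-maxˡ {M} a₂) (≤-maxˡ {M} b₂)) (k (≤-maxʳ {M} a₂) (≤-maxʳ {M} b₂))
    where
    *-close : ∀ {a b c d B C δ η} →
      0ℚ ℚ.< δ → B ℚ.* δ ≡ ½ ℚ.* ε → 0ℚ ℚ.< η → C ℚ.* η ≡ ½ ℚ.* ε →
      ℚ.∣ a ∣ ℚ.< B → ℚ.∣ d ∣ ℚ.< C → ℚ.∣ a ℚ.- b ∣ ℚ.< η → ℚ.∣ c ℚ.- d ∣ ℚ.< δ →
      ℚ.∣ a ℚ.* c ℚ.- b ℚ.* d ∣ ℚ.< ε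
    *-close {a} {b} {c} {d} {B} {C} {δ} {η} 0<δ Bδ 0<η Cη a<B d<C ab cd =
      triangle {a ℚ.* (c ℚ.- d)} {d ℚ.* (a ℚ.- b)} {ε} {a ℚ.* c ℚ.- b ℚ.* d}
        (subst (ℚ.∣ a ℚ.* (c ℚ.- d) ∣ ℚ.<_) Bδ (product {a} {c ℚ.- d} {B} {δ} 0<δ a<B cd))
        (subst (ℚ.∣ d ℚ.* (a ℚ.- b) ∣ ℚ.<_) Cη (product {d} {a ℚ.- b} {C} {η} 0<η d<C ab))
        (ℚ-identities.*-difference a b c d)

-- Eta is switched off, and the operations are defined by copatterns, to keep
-- the type checker from comparing proofs of the Cauchy property.
record ℝ : Set where
  no-eta-equality
  field
    seq    : ℕ → ℚ
    cauchy : seq ~ seq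

open ℝ public

infix  4 _≈ᴿ_ _<ᴿ_
infixl 6 _+ᴿ_
infixl 7 _*ᴿ_
infix  8 -ᴿ_

-- A record, so that the two reals can be recovered by unification.
record _≈ᴿ_ (x y : ℝ) : Set where
  constructor mk≈
  field
    close : seq x ~ seq y

open _≈ᴿ_ public

fromℚ : ℚ → ℝ
fromℚ q .seq    _ = q
fromℚ q .cauchy   = ~-const q

_+ᴿ_ : ℝ → ℝ → ℝ
(x +ᴿ y) .seq    n = seq x n ℚ.+ seq y n
(x +ᴿ y) .cauchy   = ~-+ {seq x} {seq x} {seq y} {seq y} (cauchy x) (cauchy y)

_*ᴿ_ : ℝ → ℝ → ℝ
(x *ᴿ y) .seq    n = seq x n ℚ.* seq y n
(x *ᴿ y) .cauchy   = ~-* {seq x} {seq x} {seq y} {seq y} (cauchy x) (cauchy y)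

-ᴿ_ : ℝ → ℝ
(-ᴿ x) .seq    n = ℚ.- seq x n
(-ᴿ x) .cauchy   = ~-neg {seq x} {seq x} (cauchy x)

_<ᴿ_ : Rel ℝ 0ℓ
x <ᴿ y = ∃[ ε ] (0ℚ ℚ.< ε × ∃[ N ] (∀ {n} → N ℕ.≤ n → seq x n ℚ.+ ε ℚ.< seq y n))

pointwise : ∀ {x y} → (∀ n → seq x n ≡ seq y n) → x ≈ᴿ y
pointwise {x} p = mk≈ λ ε 0<ε → let N , h = cauchy x ε 0<ε in
  N , λ {m} {n} a b → subst (λ r → ℚ.∣ seq x m ℚ.- r ∣ ℚ.< ε) (p n) (h a b)

ℝ-commutativeRing : CommutativeRing 0ℓ 0ℓ
ℝ-commutativeRing = record
  { Carrier = ℝ ; _≈_ = _≈ᴿ_ ; _+_ = _+ᴿ_ ; _*_ = _*ᴿ_ ; -_ = -ᴿ_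
  ; 0# = fromℚ 0ℚ ; 1# = fromℚ 1ℚ
  ; isCommutativeRing = record
    { isRing = record
      { +-isAbelianGroup = record
        { isGroup = record
          { isMonoid = record
            { isSemigroup = record
              { isMagma = record
                { isEquivalence = record
                  { refl  = λ {x} → mk≈ (cauchy x)
                  ; sym   = λ {x} {y} p → mk≈ (~-sym {seq x} {seq y} (close p))
                  ; trans = λ {x} {y} {z} p q →
                      mk≈ (~-trans {seq x} {seq y} {seq z} (close p) (close q))
                  }
                ; ∙-cong = λ {x} {x′} {y} {y′} p q →
                    mk≈ (~-+ {seq x} {seq x′} {seq y} {seq y′} (close p) (close q))
                }
              ; assoc = λ x y z → pointwise λ n → ℚ.+-assoc (seq x n) (seq y n) (seq z n)
              }
            ; identity = (λ x → pointwise λ n → ℚ.+-identityˡ (seq x n))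
                       , (λ x → pointwise λ n → ℚ.+-identityʳ (seq x n))
            }
          ; inverse = (λ x → pointwise λ n → ℚ.+-inverseˡ (seq x n))
                    , (λ x → pointwise λ n → ℚ.+-inverseʳ (seq x n))
          ; ⁻¹-cong = λ {x} {x′} p → mk≈ (~-neg {seq x} {seq x′} (close p))
          }
        ; comm = λ x y → pointwise λ n → ℚ.+-comm (seq x n) (seq y n)
        }
      ; *-cong = λ {x} {x′} {y} {y′} p q →
          mk≈ (~-* {seq x} {seq x′} {seq y} {seq y′} (close p) (close q))
      ; *-assoc = λ x y z → pointwise λ n → ℚ.*-assoc (seq x n) (seq y n) (seq z n)
      ; *-identity = (λ x → pointwise λ n → ℚ.*-identityˡ (seq x n))
                   , (λ x → pointwise λ n → ℚ.*-identityʳ (seq x n))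
      ; distrib = (λ x y z → pointwise λ n → ℚ.*-distribˡ-+ (seq x n) (seq y n) (seq z n))
                , (λ x y z → pointwise λ n → ℚ.*-distribʳ-+ (seq x n) (seq y n) (seq z n))
      }
    ; *-comm = λ x y → pointwise λ n → ℚ.*-comm (seq x n) (seq y n)
    }
  }

infix 4 _≈ᶜ_
infix 5 _+i_

record ℂ : Set where
  constructor _+i_
  field
    re im : ℝ

open ℂ public

infixr 4 _∧_

record _≈ᶜ_ (z w : ℂ) : Set where
  constructor _∧_
  field
    re≈ : re z ≈ᴿ re w
    im≈ : im z ≈ᴿ im w

open _≈ᶜ_ public

conj : ℂ → ℂ
conj (x +i y) = x +i (-ᴿ y)

private
  module ℂ-laws where
    open Identities ℝ-commutativeRing
    module R = CommutativeRing ℝ-commutativeRing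

    infixl 6 _+_
    infixl 7 _*_

    _+_ _*_ : ℂ → ℂ → ℂ
    (a +i b) + (c +i d) = (a +ᴿ c) +i (b +ᴿ d)
    (a +i b) * (c +i d) = (a *ᴿ c +ᴿ -ᴿ (b *ᴿ d)) +i (a *ᴿ d +ᴿ b *ᴿ c)

    1ᶜ : ℂ
    1ᶜ = R.1# +i R.0#

    ≈ᶜ-trans : ∀ {x y z} → x ≈ᶜ y → y ≈ᶜ z → x ≈ᶜ z
    ≈ᶜ-trans (p ∧ q) (r ∧ s) = R.trans p r ∧ R.trans q s

    +-cong : ∀ {x y z w} → x ≈ᶜ y → z ≈ᶜ w → x + z ≈ᶜ y + w
    +-cong (p ∧ q) (r ∧ s) = R.+-cong p r ∧ R.+-cong q s

    *-assoc : ∀ x y z → (x * y) * z ≈ᶜ x * (y * z)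
    *-assoc (a +i b) (c +i d) (e +i f) = assoc-re a b c d e f ∧ assoc-im a b c d e f

    *-comm : ∀ x y → x * y ≈ᶜ y * x
    *-comm (a +i b) (c +i d) = comm-re a b c d ∧ comm-im a b c d

    *-identityˡ : ∀ x → 1ᶜ * x ≈ᶜ x
    *-identityˡ (a +i b) = identity-re a b ∧ identity-im a b

    distribˡ : ∀ x y z → x * (y + z) ≈ᶜ x * y + x * z
    distribˡ (a +i b) (c +i d) (e +i f) = distrib-re a b c d e f ∧ distrib-im a b c d e f

ℂ-commutativeRing : CommutativeRing 0ℓ 0ℓ
ℂ-commutativeRing = record
  { Carrier = ℂ ; _≈_ = _≈ᶜ_
  ; _+_ = λ z w → (re z +ᴿ re w) +i (im z +ᴿ im w)
  ; _*_ = λ z w → (re z *ᴿ re w +ᴿ -ᴿ (im z *ᴿ im w)) +i (re z *ᴿ im w +ᴿ im z *ᴿ re w)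
  ; -_ = λ z → (-ᴿ re z) +i (-ᴿ im z)
  ; 0# = R.0# +i R.0# ; 1# = R.1# +i R.0#
  ; isCommutativeRing = record
    { isRing = record
      { +-isAbelianGroup = record
        { isGroup = record
          { isMonoid = record
            { isSemigroup = record
              { isMagma = record
                { isEquivalence = record
                  { refl  = R.refl ∧ R.refl
                  ; sym   = λ (p ∧ q) → R.sym p ∧ R.sym q
                  ; trans = ≈ᶜ-trans
                  }
                ; ∙-cong = +-cong
                }
              ; assoc = λ _ _ _ → R.+-assoc _ _ _ ∧ R.+-assoc _ _ _
              }
            ; identity = (λ _ → R.+-identityˡ _ ∧ R.+-identityˡ _)
                       , (λ _ → R.+-identityʳ _ ∧ R.+-identityʳ _)
            }
          ; inverse = (λ _ → R.-‿inverseˡ _ ∧ R.-‿inverseˡ _)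
                    , (λ _ → R.-‿inverseʳ _ ∧ R.-‿inverseʳ _)
          ; ⁻¹-cong = λ (p ∧ q) → R.-‿cong p ∧ R.-‿cong q
          }
        ; comm = λ _ _ → R.+-comm _ _ ∧ R.+-comm _ _
        }
      ; *-cong = λ (p ∧ q) (r ∧ s) →
            R.+-cong (R.*-cong p r) (R.-‿cong (R.*-cong q s))
          ∧ R.+-cong (R.*-cong p s) (R.*-cong q r)
      ; *-assoc = *-assoc
      ; *-identity = *-identityˡ , (λ x → ≈ᶜ-trans (*-comm x 1ᶜ) (*-identityˡ x))
      ; distrib = distribˡ
                , (λ x y z → ≈ᶜ-trans (*-comm (y + z) x)
                    (≈ᶜ-trans (distribˡ x y z) (+-cong (*-comm x y) (*-comm x z))))
      }
    ; *-comm = *-comm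
    }
  }
  where open ℂ-laws

module _ {a b ℓ₁ ℓ₂} {A : Set a} {B : Set b} (_≈₁_ : Rel A ℓ₁) (_≈₂_ : Rel B ℓ₂) where

  -- The map of quotients A/≈₁ → B/≈₂ induced by f is a bijection.
  BijectiveOnClasses : (A → B) → Set _
  BijectiveOnClasses f = Congruent _≈₁_ _≈₂_ f × Bijective _≈₁_ _≈₂_ f

HasCardinality : ∀ {a ℓ} (A : Set a) → Rel A ℓ → ℕ → Set _
HasCardinality A _≈_ n = ∃ λ (f : Fin n → A) → BijectiveOnClasses _≡_ _≈_ f

module _ (G : RawGroup 0ℓ 0ℓ) where
  open RawGroup G

  record IsSubgroup (H : Pred Carrier 0ℓ) : Set where
    field
      respects  : H Respects _≈_
      ε-closed  : ε ∈ H
      ∙-closed  : ∀ {x y} → x ∈ H → y ∈ H → x ∙ y ∈ H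
      ⁻¹-closed : ∀ {x} → x ∈ H → x ⁻¹ ∈ H

  private
    open RawMonoidDefs rawMonoid using () renaming (_×_ to _times_)

  power : Carrier → ℤ → Carrier
  power g (ℤ.+ n)    = n times g
  power g ℤ.-[1+ n ] = (ℕ.suc n times g) ⁻¹

  IsCyclic : Pred Carrier 0ℓ → Set
  IsCyclic H = ∃[ g ] (g ∈ H × (∀ {x} → x ∈ H → ∃[ k ] x ≈ power g k))

  IsNontrivial : Pred Carrier 0ℓ → Set
  IsNontrivial H = ∃[ x ] (x ∈ H × ¬ x ≈ ε)

ℂ-module ℂ²-module : Module ℂ-commutativeRing 0ℓ 0ℓ
ℂ-module  = TensorUnit.⟨module⟩
ℂ²-module = DirectProduct.⟨module⟩ ℂ-module ℂ-module

private
  module C  = CommutativeRing ℂ-commutativeRing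
  module C² = Module ℂ²-module

ℂ² : Set
ℂ² = C².Carrierᴹ

infixl 6 _-²_

_-²_ : ℂ² → ℂ² → ℂ²
z -² w = z C².+ᴹ (C².-ᴹ w)

Torus : Pred ℂ² 0ℓ → RawGroup 0ℓ 0ℓ
Torus L = record
  { Carrier = ℂ²
  ; _≈_     = λ z w → z -² w ∈ L
  ; _∙_     = C²._+ᴹ_
  ; ε       = C².0ᴹ
  ; _⁻¹     = C².-ᴹ_
  }

IsLinear : (ℂ² → ℂ²) → Set
IsLinear = IsModuleHomomorphism
  where open ModuleMorphisms C².rawModule C².rawModule

IsLinearForm : (ℂ² → ℂ) → Set
IsLinearForm = IsModuleHomomorphism
  where open ModuleMorphisms C².rawModule (Module.rawModule ℂ-module)

‖_‖² : ℂ² → ℝ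
‖ (z , w) ‖² = re z *ᴿ re z +ᴿ im z *ᴿ im z +ᴿ (re w *ᴿ re w +ᴿ im w *ᴿ im w)

BoundedBy : ℚ → Pred ℂ² 0ℓ
BoundedBy r (z , w) = small (re z) × small (im z) × small (re w) × small (im w)
  where
  small : ℝ → Set
  small x = fromℚ (ℚ.- r) <ᴿ x × x <ᴿ fromℚ r

-- A positive definite Hermitian form whose imaginary part is integral on L.
record RiemannForm (L : Pred ℂ² 0ℓ) : Set where
  field
    H         : ℂ² → ℂ² → ℂ
    linear    : ∀ w → IsLinearForm (λ z → H z w)
    hermitian : ∀ z w → H w z ≈ᶜ conj (H z w)
    -- 0 < ‖ z ‖² is the positive formulation of z ≠ 0.
    positive  : ∀ z → fromℚ 0ℚ <ᴿ ‖ z ‖² → fromℚ 0ℚ <ᴿ re (H z z)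
    integral  : ∀ {z w} → z ∈ L → w ∈ L → ∃[ k ] im (H z w) ≈ᴿ fromℚ (k ℚ./ 1)

-- ℂ²/L is a polarizable complex torus; the first three fields say that L is a
-- lattice of full rank.
record IsAbelianSurface (L : Pred ℂ² 0ℓ) : Set where
  field
    isSubgroup  : IsSubgroup C².+ᴹ-rawGroup L
    discrete    : ∃[ ε ] (0ℚ ℚ.< ε × (∀ {z} → z ∈ L → BoundedBy ε z → z C².≈ᴹ C².0ᴹ))
    cocompact   : ∃[ r ] (∀ z → ∃[ w ] (w ∈ L × BoundedBy r (z -² w)))
    polarizable : RiemannForm L

-- Homomorphisms ℂ²/L → ℂ²/L′ of complex tori, given by their lift to ℂ².
record IsTorusHomomorphism (L L′ : Pred ℂ² 0ℓ) (f : ℂ² → ℂ²) : Set where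
  field
    isLinear    : IsLinear f
    mapsLattice : ∀ {z} → z ∈ L → f z ∈ L′

module _ (L L′ : Pred ℂ² 0ℓ) where
  private
    module A  = RawGroup (Torus L)
    module A′ = RawGroup (Torus L′)

  Kernel : (ℂ² → ℂ²) → Pred ℂ² 0ℓ
  Kernel f z = f z A′.≈ A′.ε

  record IsIsogeny (f : ℂ² → ℂ²) : Set where
    field
      isTorusHomomorphism : IsTorusHomomorphism L L′ f
      surjective          : Surjective A._≈_ A′._≈_ f
      finiteKernel        : ∃ (HasCardinality (Σ ℂ² (Kernel f)) (λ x y → proj₁ x A.≈ proj₁ y))

  record IsTorusIsomorphism (f : ℂ² → ℂ²) : Set where
    field
      isTorusHomomorphism : IsTorusHomomorphism L L′ f
      bijective           : Bijective A._≈_ A′._≈_ f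

-- H is a nontrivial cyclic subgroup of M/L ⊂ ℂ²/L.
record IsNontrivialCyclicSubgroup (L M H : Pred ℂ² 0ℓ) : Set where
  field
    isSubgroup : IsSubgroup (Torus L) H
    contained  : H ⊆ M
    cyclic     : IsCyclic (Torus L) H
    nontrivial : IsNontrivial (Torus L) H

-- f : ℂ²/L → ℂ²/L′ is an isogeny of abelian surfaces whose kernel is a
-- nontrivial cyclic subgroup of M/L.
record IsCyclicIsogeny (L M L′ : Pred ℂ² 0ℓ) (f : ℂ² → ℂ²) : Set where
  field
    codomain-isAbelianSurface : IsAbelianSurface L′
    isIsogeny                 : IsIsogeny L L′ f
    kernel-isCyclic           : IsNontrivialCyclicSubgroup L M (Kernel L L′ f)

module _ (L M : Pred ℂ² 0ℓ) where

  NontrivialCyclicSubgroup : Set₁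
  NontrivialCyclicSubgroup = ∃[ H ] IsNontrivialCyclicSubgroup L M H

  _≈-subgroup_ : Rel NontrivialCyclicSubgroup 0ℓ
  (H , _) ≈-subgroup (H′ , _) = H ≐ H′

  record CyclicIsogeny : Set₁ where
    constructor mkCyclicIsogeny
    field
      codomain        : Pred ℂ² 0ℓ
      map             : ℂ² → ℂ²
      isCyclicIsogeny : IsCyclicIsogeny L M codomain map

  open CyclicIsogeny

  kernel : CyclicIsogeny → NontrivialCyclicSubgroup
  kernel f = Kernel L (codomain f) (map f) , IsCyclicIsogeny.kernel-isCyclic (isCyclicIsogeny f)

  -- g is the composite of f with an isomorphism of the codomains.
  _≅-isogeny_ : Rel CyclicIsogeny 0ℓ
  f ≅-isogeny g = ∃[ h ]
    ( IsTorusIsomorphism (codomain f) (codomain g) h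
    × (∀ z → RawGroup._≈_ (Torus (codomain g)) (h (map f z)) (map g z)) )

record CharZeroField : Set₁ where
  field
    commutativeRing : CommutativeRing 0ℓ 0ℓ

  open CommutativeRing commutativeRing public

  field
    0≉1     : ¬ 0# ≈ 1#
    inverse : ∀ x → ¬ x ≈ 0# → ∃[ y ] x * y ≈ 1#
    ι       : ℚ → Carrier
    ι-isRingHomomorphism : RingMorphisms.IsRingHomomorphism ℚ.+-*-rawRing rawRing ι

record Embedding (R : RawRing 0ℓ 0ℓ) : Set where
  field
    ⟦_⟧ : RawRing.Carrier R → ℂ
    isRingHomomorphism : RingMorphisms.IsRingHomomorphism R C.rawRing ⟦_⟧

IsReal : ∀ {R} → Embedding R → Set
IsReal φ = ∀ x → im (⟦ x ⟧) ≈ᴿ fromℚ 0ℚ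
  where open Embedding φ

TotallyReal TotallyImaginary : RawRing 0ℓ 0ℓ → Set
TotallyReal      R = (φ : Embedding R) → IsReal φ
TotallyImaginary R = (φ : Embedding R) → ¬ IsReal φ

module FieldTheory (K : CharZeroField) where
  open CharZeroField K
  open RawMonoidDefs +-rawMonoid using (sum)
  open RawSemiringDefs (RawRing.rawSemiring rawRing) using (_^_)

  Subset : Set₁
  Subset = Pred Carrier 0ℓ

  record IsSubring (R : Subset) : Set where
    field
      respects  : R Respects _≈_
      0#-closed : 0# ∈ R
      1#-closed : 1# ∈ R
      +-closed  : ∀ {x y} → x ∈ R → y ∈ R → x + y ∈ R
      *-closed  : ∀ {x y} → x ∈ R → y ∈ R → x * y ∈ R
      -‿closed  : ∀ {x} → x ∈ R → - x ∈ R

    subring : RawRing 0ℓ 0ℓ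
    subring = record
      { Carrier = Σ Carrier R
      ; _≈_     = λ x y → proj₁ x ≈ proj₁ y
      ; _+_     = λ (_ , p) (_ , q) → _ , +-closed p q
      ; _*_     = λ (_ , p) (_ , q) → _ , *-closed p q
      ; -_      = λ (_ , p) → _ , -‿closed p
      ; 0#      = _ , 0#-closed
      ; 1#      = _ , 1#-closed
      }

  record IsSubfield (F : Subset) : Set where
    field
      isSubring      : IsSubring F
      inverse-closed : ∀ {x y} → x ∈ F → x * y ≈ 1# → y ∈ F

    open IsSubring isSubring public

  Rational Integer : Subset
  Rational x = ∃[ q ] ι q ≈ x
  Integer  x = ∃[ k ] ι (k ℚ./ 1) ≈ x

  combination : ∀ {n} → (Fin n → Carrier) → (Fin n → Carrier) → Carrier
  combination c b = sum (λ i → c i * b i)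

  record IsBasis (R M : Subset) {n} (b : Fin n → Carrier) : Set where
    field
      elements    : ∀ i → b i ∈ M
      spanning    : ∀ {x} → x ∈ M → ∃[ c ] ((∀ i → c i ∈ R) × x ≈ combination c b)
      independent : ∀ c → (∀ i → c i ∈ R) → combination c b ≈ 0# → ∀ i → c i ≈ 0#

  HasRank : (R M : Subset) → ℕ → Set
  HasRank R M n = ∃ λ (b : Fin n → Carrier) → IsBasis R M b

  Integral : Subset
  Integral x = ∃[ n ] ∃ λ (a : Fin n → Carrier) →
    (∀ i → a i ∈ Integer) × x ^ n + combination a (λ i → x ^ toℕ i) ≈ 0#

  𝒪[_] : Subset → Subset
  𝒪[ F ] x = x ∈ F × Integral x

  infixl 6 _⊕_
  infixl 7 _·_
  infixr 8 _•_

  _⊕_ : Subset → Subset → Subset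
  (I ⊕ J) x = ∃[ a ] ∃[ b ] (a ∈ I × b ∈ J × x ≈ a + b)

  _·_ : Subset → Subset → Subset
  (I · J) x = ∃[ n ] ∃ λ (a : Fin n → Carrier) → ∃ λ (b : Fin n → Carrier) →
    (∀ i → a i ∈ I) × (∀ i → b i ∈ J) × x ≈ combination a b

  _•_ : Carrier → Subset → Subset
  (α • I) x = ∃[ a ] (a ∈ I × x ≈ α * a)

record QuarticCMField : Set₁ where
  field
    K : CharZeroField

  open CharZeroField K public
  open FieldTheory K public

  field
    [K:ℚ]≡4             : HasRank Rational U 4
    K-totallyImaginary  : TotallyImaginary rawRing
    K₀                  : Subset
    K₀-isSubfield       : IsSubfield K₀
    [K₀:ℚ]≡2            : HasRank Rational K₀ 2
    [K:K₀]≡2            : HasRank K₀ U 2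
    K₀-totallyReal      : TotallyReal (IsSubfield.subring K₀-isSubfield)

  Primitive : Set₁
  Primitive = ¬ (∃[ F ] Σ[ isSubfield ∈ IsSubfield F ]
    (HasRank Rational F 2 × TotallyImaginary (IsSubfield.subring isSubfield)))

  record CMType : Set where
    field
      φ₁ φ₂ : Embedding rawRing

    open Embedding φ₁ public using () renaming (⟦_⟧ to ⟦_⟧₁)
    open Embedding φ₂ public using () renaming (⟦_⟧ to ⟦_⟧₂)

    field
      distinct     : ¬ (∀ x → ⟦ x ⟧₁ ≈ᶜ ⟦ x ⟧₂)
      nonConjugate : ¬ (∀ x → ⟦ x ⟧₁ ≈ᶜ conj ⟦ x ⟧₂)

    Φ : Carrier → ℂ²
    Φ x = ⟦ x ⟧₁ , ⟦ x ⟧₂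

    Φ[_] : Subset → Pred ℂ² 0ℓ
    Φ[ Λ ] z = ∃[ x ] (x ∈ Λ × Φ x C².≈ᴹ z)

    act : Carrier → ℂ² → ℂ²
    act α (z , w) = ⟦ α ⟧₁ C.* z , ⟦ α ⟧₂ C.* w

  record IsOrder (𝒪 : Subset) : Set where
    field
      isSubring : IsSubring 𝒪
      ℤ-rank    : HasRank Integer 𝒪 4

  -- α ↦ act α is an isomorphism from 𝒪 onto the endomorphism ring of ℂ²/L.
  record HasComplexMultiplication (Φ : CMType) (𝒪 : Subset) (L : Pred ℂ² 0ℓ) : Set where
    open CMType Φ using (act)
    field
      acts      : ∀ {α} → α ∈ 𝒪 → IsTorusHomomorphism L L (act α)
      exhausted : ∀ {f} → IsTorusHomomorphism L L f →
                  ∃[ α ] (α ∈ 𝒪 × (∀ z → f z C².≈ᴹ act α z))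

  𝒪₀ : Subset
  𝒪₀ = 𝒪[ K₀ ]

  record IsFractionalIdeal (I : Subset) : Set where
    field
      respects          : I Respects _≈_
      contained         : I ⊆ K₀
      0#-closed         : 0# ∈ I
      +-closed          : ∀ {x y} → x ∈ I → y ∈ I → x + y ∈ I
      *-closed          : ∀ {r x} → r ∈ 𝒪₀ → x ∈ I → r * x ∈ I
      nonzero           : ∃[ x ] (x ∈ I × ¬ x ≈ 0#)
      finitelyGenerated : ∃[ n ] ∃ λ (g : Fin n → Carrier) → (∀ i → g i ∈ I) ×
        (∀ {x} → x ∈ I → ∃[ c ] ((∀ i → c i ∈ 𝒪₀) × x ≈ combination c g))

  infix 9 _⁻¹

  _⁻¹ : Subset → Subset
  (I ⁻¹) x = x ∈ K₀ × (∀ {y} → y ∈ I → x * y ∈ 𝒪₀)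

  FractionalIdeal : Set₁
  FractionalIdeal = ∃[ I ] IsFractionalIdeal I

  SameIdealClass : Rel FractionalIdeal 0ℓ
  SameIdealClass (I , _) (J , _) = ∃[ α ] (α ∈ K₀ × ¬ α ≈ 0# × I ≐ α • J)

  K₀-HasClassNumber : ℕ → Set₁
  K₀-HasClassNumber = HasCardinality FractionalIdeal SameIdealClass

  -- Zero is excluded, fractional ideals being nonzero.
  record IsPrimeIdeal (𝔭 : Subset) : Set where
    field
      isFractionalIdeal : IsFractionalIdeal 𝔭
      integral          : 𝔭 ⊆ 𝒪₀
      proper            : 1# ∉ 𝔭
      prime             : ∀ {x y} → x ∈ 𝒪₀ → y ∈ 𝒪₀ → x * y ∈ 𝔭 → x ∈ 𝔭 ⊎ y ∈ 𝔭

  HasNorm : Subset → ℕ → Set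
  HasNorm I = HasCardinality (Σ Carrier 𝒪₀) (λ x y → proj₁ x - proj₁ y ∈ I)

  module Isogenies (𝔩 Λ₁ Λ₂ : Subset) (τ : Carrier) where

    -- The index set {∞} ∪ Λ₁Λ₂⁻¹/𝔩Λ₁Λ₂⁻¹; nothing stands for ∞.
    Index : Set
    Index = Maybe (Σ Carrier (Λ₁ · Λ₂ ⁻¹))

    _≈-index_ : Rel Index 0ℓ
    _≈-index_ = Pointwise (λ ρ ρ′ → proj₁ ρ - proj₁ ρ′ ∈ 𝔩 · (Λ₁ · Λ₂ ⁻¹))

    overlattice : Index → Subset
    overlattice nothing        = 𝔩 ⁻¹ · Λ₁ ⊕ τ • Λ₂
    overlattice (just (ρ , _)) = Λ₁ ⊕ (τ + ρ) • (𝔩 ⁻¹ · Λ₂)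

{-# OPTIONS --safe #-}
-- Class number one makes 𝔩 = π𝒪₀, Λ₁ = α𝒪₀ and Λ₂ = β𝒪₀ principal, so
-- (𝔩⁻¹Λ)/Λ is a plane over 𝒪₀/𝔩 with basis e₁ = α/π, e₂ = τβ/π.  Since 𝒪₀/𝔩 has
-- prime order, every nonzero residue generates it additively, and the
-- nontrivial cyclic subgroups are the lines of this plane: the line through e₁
-- belongs to ∞ and the line through re₁ + e₂ to ρ = αβ⁻¹r.  The surfaces
-- ℂ²/Φ(Λ′) with Λ ⊂ Λ′ ⊂ 𝔩⁻¹Λ inherit discreteness and a Riemann form from
-- ℂ²/Φ(Λ) through multiplication by ℓ, which maps Λ′ into Λ.
--
-- That 𝒪₀ is a ring at all is deduced from the order 𝒪 ⊇ 𝒪₀: an element u of 𝒪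
-- satisfies a linear system u vᵢ = Σⱼ cᵢⱼ vⱼ with integral coefficients, and
-- eliminating the vᵢ without division leaves a monic equation for u.
module Submission where

open import Defs
open import Algebra.Bundles using (AbelianGroup; CommutativeRing; RawRing)
import Algebra.Definitions.RawMonoid as RawMonoidDefs
import Algebra.Definitions.RawSemiring as RawSemiringDefs
open import Algebra.Module.Bundles using (Module)
import Algebra.Module.Morphism.Construct.Composition as Composition
import Algebra.Module.Morphism.Construct.Identity as Identity
open import Algebra.Module.Morphism.Structures using (module ModuleMorphisms)
open import Algebra.Morphism.Structures using (module RingMorphisms)
import Algebra.Properties.AbelianGroup as AbelianGroupProperties
import Algebra.Properties.CommutativeMonoid.Sum as CommutativeMonoidSum
import Algebra.Properties.CommutativeSemigroup as CommutativeSemigroupProperties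
import Algebra.Properties.Ring as RingProperties
import Algebra.Properties.Semiring.Mult as SemiringMult
import Algebra.Properties.Semiring.Sum as SemiringSum
import Algebra.Solver.CommutativeMonoid as CommutativeMonoidSolver
import Algebra.Solver.Ring.NaturalCoefficients.Default as NaturalCoefficients
open import Data.Empty using (⊥; ⊥-elim)
open import Data.Fin.Base using (Fin; zero; suc; toℕ)
import Data.Fin.Permutation as Permutation
import Data.Fin.Properties as Fin
open import Data.Integer.Base as ℤ using (ℤ)
import Data.Integer.Properties as ℤ
open import Data.Maybe.Base using (just; nothing)
open import Data.Maybe.Relation.Binary.Pointwise using (just; nothing)
open import Data.Nat.Base as ℕ using (ℕ; zero; suc)
open import Data.Nat.Coprimality as Coprimality using (Coprime; coprime-Bézout)
open import Data.Nat.GCD using (module Bézout)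
open import Data.Nat.Primality using (Prime; prime⇒nonZero)
import Data.Nat.Properties as ℕ
open import Data.Product.Base using (Σ; Σ-syntax; ∃; ∃-syntax; _×_; _,_; proj₁; proj₂)
open import Data.Rational.Base as ℚ using (ℚ; 0ℚ; 1ℚ)
open import Data.Rational.Literals using (fromℤ)
import Data.Rational.Properties as ℚ
open import Data.Sum.Base using (_⊎_; inj₁; inj₂)
open import Function.Base using (_∘_; id; case_of_)
open import Level using (0ℓ)
open import Relation.Binary.Definitions using (_Respects_; tri<; tri≈; tri>)
open import Relation.Binary.PropositionalEquality as ≡ using (_≡_)
import Relation.Binary.Reasoning.Setoid as SetoidReasoning
open import Relation.Nullary.Decidable using (Dec; yes; no)
open import Relation.Nullary.Negation using (¬_)
open import Relation.Unary using (Pred; _∈_; _∉_; _⊆_; _≐_; U)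

-- The argument is constructive. Neither equality in `K` nor membership in 𝔩 comes with a decision
-- procedure, although division asks for a nonzero element and the choice of a line asks which
-- coordinates vanish modulo 𝔩. Finite data meet both needs: a ℚ-basis reduces equations in `K` to
-- equations in ℚ, and the norm of 𝔩 is an enumeration of 𝒪₀/𝔩 by `Fin ℓ`, on which residues can be
-- compared. The field 𝒪₀/𝔩 is never constructed. Inverting a residue b means finding, by counting,
-- a natural number j with j b ≡ 1 mod 𝔩. Natural multipliers are also what a cyclic group asks for,
-- so one device both normalises a vector and generates its line. The integrality argument replaces
-- the determinant of the relation matrix by elimination, at the price of the degree: four unknowns
-- give a monic equation of degree 8 instead of 4.

module C  = CommutativeRing ℂ-commutativeRing
module C² = Module ℂ²-module
open AbelianGroupProperties C².+ᴹ-abelianGroup using (ε⁻¹≈ε; ⁻¹-anti-homo‿-)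

-- Congruence modulo a subgroup of ℂ²

-²0≈ : ∀ z → z -² C².0ᴹ C².≈ᴹ z
-²0≈ z = C².≈ᴹ-trans (C².+ᴹ-congˡ {z} ε⁻¹≈ε) (C².+ᴹ-identityʳ z)

-²-+ : ∀ z w → (z -² w) C².+ᴹ w C².≈ᴹ z
-²-+ z w = begin
  (z C².+ᴹ C².-ᴹ w) C².+ᴹ w    ≈⟨ C².+ᴹ-assoc z (C².-ᴹ w) w ⟩
  z C².+ᴹ (C².-ᴹ w C².+ᴹ w)    ≈⟨ C².+ᴹ-congˡ {z} (C².-ᴹ‿inverseˡ w) ⟩
  z C².+ᴹ C².0ᴹ                ≈⟨ C².+ᴹ-identityʳ z ⟩
  z                            ∎
  where open SetoidReasoning C².≈ᴹ-setoid

-²-telescope : ∀ z w v → (z -² w) C².+ᴹ (w -² v) C².≈ᴹ z -² v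
-²-telescope z w v = C².≈ᴹ-trans (C².≈ᴹ-sym (C².+ᴹ-assoc (z -² w) w (C².-ᴹ v)))
  (C².+ᴹ-congʳ {C².-ᴹ v} (-²-+ z w))

module Subgroup {L : Pred ℂ² 0ℓ} (L-subgroup : IsSubgroup C².+ᴹ-rawGroup L) where
  open IsSubgroup L-subgroup public

  ≈⇒-² : ∀ {z w} → z C².≈ᴹ w → z -² w ∈ L
  ≈⇒-² {z} {w} z≈w = respects
    (C².≈ᴹ-sym (C².≈ᴹ-trans (C².+ᴹ-congʳ {C².-ᴹ w} z≈w) (C².-ᴹ‿inverseʳ w))) ε-closed

  -²-sym : ∀ {z w} → z -² w ∈ L → w -² z ∈ L
  -²-sym {z} {w} p = respects (⁻¹-anti-homo‿- z w) (⁻¹-closed p)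

  -²-trans : ∀ {z w v} → z -² w ∈ L → w -² v ∈ L → z -² v ∈ L
  -²-trans {z} {w} {v} p q = respects (-²-telescope z w v) (∙-closed p q)

  absorb : ∀ {z w} → z -² w ∈ L → w ∈ L → z ∈ L
  absorb {z} {w} p q = respects (-²-+ z w) (∙-closed p q)

  ∈⇒-²0 : ∀ {z} → z ∈ L → z -² C².0ᴹ ∈ L
  ∈⇒-²0 {z} = respects (C².≈ᴹ-sym (-²0≈ z))

  -²0⇒∈ : ∀ {z} → z -² C².0ᴹ ∈ L → z ∈ L
  -²0⇒∈ {z} = respects (-²0≈ z)

  -- The operations of `Torus L′` are those of ℂ²; only its equality depends on `L′`. Powers formed
  -- in ℂ²/L can therefore be tested for membership in a larger lattice.
  power-closed : ∀ {L′ : Pred ℂ² 0ℓ} {g} → g ∈ L → ∀ k → power (Torus L′) g k ∈ L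
  power-closed {L′} {g} g∈L (ℤ.+ n) = times-closed n
    where
    times-closed : ∀ n → power (Torus L′) g (ℤ.+ n) ∈ L
    times-closed zero    = ε-closed
    times-closed (suc n) = ∙-closed g∈L (times-closed n)
  power-closed {L′} g∈L ℤ.-[1+ n ] = ⁻¹-closed (power-closed {L′} g∈L (ℤ.+ suc n))

identity-isLinear : IsLinear id
identity-isLinear = Identity.isModuleHomomorphism C².rawModule C².≈ᴹ-refl

-- The projection ℂ²/L → ℂ²/L′ for L′/L cyclic of order n

module Quotient {L L′ M : Pred ℂ² 0ℓ}
  (L-subgroup : IsSubgroup C².+ᴹ-rawGroup L) (L′-subgroup : IsSubgroup C².+ᴹ-rawGroup L′)
  (L⊆L′ : L ⊆ L′) (L′⊆M : L′ ⊆ M)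
  (g : ℂ²) (g∈L′ : g ∈ L′) (g∉L : g ∉ L) (n : ℕ)
  (spans : ∀ {z} → z ∈ L′ → ∃[ j ] z -² power (Torus L) g (ℤ.+ toℕ {n} j) ∈ L)
  (distinct : ∀ {i j : Fin n} →
    power (Torus L) g (ℤ.+ toℕ i) -² power (Torus L) g (ℤ.+ toℕ j) ∈ L → i ≡ j)
  where
  private
    module L  = Subgroup L-subgroup
    module L′ = Subgroup L′-subgroup

  identity-isIsogeny : IsIsogeny L L′ (λ z → z)
  identity-isIsogeny = record
    { isTorusHomomorphism = record { isLinear = identity-isLinear ; mapsLattice = L⊆L′ }
    ; surjective          = λ z → z , λ p → L⊆L′ p
    ; finiteKernel        = n , f , f-cong , f-injective , f-surjective
    }
    where
    _≈_ : Σ ℂ² (Kernel L L′ id) → Σ ℂ² (Kernel L L′ id) → Set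
    x ≈ y = proj₁ x -² proj₁ y ∈ L
    f : Fin n → Σ ℂ² (Kernel L L′ (λ z → z))
    f j = power (Torus L) g (ℤ.+ toℕ j) , L′.∈⇒-²0 (L′.power-closed {L} g∈L′ (ℤ.+ toℕ j))
    f-cong : ∀ {i j} → i ≡ j → f i ≈ f j
    f-cong ≡.refl = L.≈⇒-² C².≈ᴹ-refl
    f-injective : ∀ {i j} → f i ≈ f j → i ≡ j
    f-injective = distinct
    f-surjective : ∀ y → ∃[ j ] (∀ {i} → i ≡ j → f i ≈ y)
    f-surjective (z , p) = let j , q = spans (L′.-²0⇒∈ p) in j , λ { ≡.refl → L.-²-sym q }

  kernel-isNontrivialCyclic : IsNontrivialCyclicSubgroup L M (Kernel L L′ (λ z → z))
  kernel-isNontrivialCyclic = record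
    { isSubgroup = record
      { respects  = λ p q → L′.-²-trans (L′.-²-sym (L⊆L′ p)) q
      ; ε-closed  = L′.∈⇒-²0 L′.ε-closed
      ; ∙-closed  = λ p q → L′.∈⇒-²0 (L′.∙-closed (L′.-²0⇒∈ p) (L′.-²0⇒∈ q))
      ; ⁻¹-closed = λ p → L′.∈⇒-²0 (L′.⁻¹-closed (L′.-²0⇒∈ p))
      }
    ; contained  = λ p → L′⊆M (L′.-²0⇒∈ p)
    ; cyclic     = g , L′.∈⇒-²0 g∈L′ , λ p → let j , q = spans (L′.-²0⇒∈ p) in ℤ.+ toℕ j , q
    ; nontrivial = g , L′.∈⇒-²0 g∈L′ , λ p → g∉L (L.-²0⇒∈ p)
    }

-- Multiplication by n on ℂ² and on its bounds

_•²_ : ℕ → ℂ² → ℂ²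
zero  •² z = C².0ᴹ
suc n •² z = z C².+ᴹ (n •² z)

•²-cong : ∀ n {z w} → z C².≈ᴹ w → n •² z C².≈ᴹ n •² w
•²-cong zero    z≈w = C².≈ᴹ-refl
•²-cong (suc n) z≈w = C².+ᴹ-cong z≈w (•²-cong n z≈w)

•²-isLinear : ∀ n → IsLinear (n •²_)
•²-isLinear n = record { isBimoduleHomomorphism = record
  { +ᴹ-isGroupHomomorphism = record
    { isMonoidHomomorphism = record
      { isMagmaHomomorphism = record
        { isRelHomomorphism = record { cong = λ {z} {w} → •²-cong n {z} {w} }
        ; homo = •²-+ n
        }
      ; ε-homo = •²-0 n
      }
    ; ⁻¹-homo = •²-neg n
    }
  ; *ₗ-homo = •²-*ₗ n
  ; *ᵣ-homo = •²-*ᵣ n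
  } }
  where
  open AbelianGroupProperties C².+ᴹ-abelianGroup using (⁻¹-∙-comm)
  open CommutativeSemigroupProperties (AbelianGroup.commutativeSemigroup C².+ᴹ-abelianGroup) using (interchange)

  •²-+ : ∀ n z w → n •² (z C².+ᴹ w) C².≈ᴹ (n •² z) C².+ᴹ (n •² w)
  •²-+ zero    z w = C².≈ᴹ-sym (C².+ᴹ-identityˡ C².0ᴹ)
  •²-+ (suc n) z w = C².≈ᴹ-trans (C².+ᴹ-congˡ {z C².+ᴹ w} (•²-+ n z w)) (interchange z w (n •² z) (n •² w))

  •²-0 : ∀ n → n •² C².0ᴹ C².≈ᴹ C².0ᴹ
  •²-0 zero    = C².≈ᴹ-refl
  •²-0 (suc n) = C².≈ᴹ-trans (C².+ᴹ-identityˡ (n •² C².0ᴹ)) (•²-0 n)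

  •²-neg : ∀ n z → n •² (C².-ᴹ z) C².≈ᴹ C².-ᴹ (n •² z)
  •²-neg zero    z = C².≈ᴹ-sym ε⁻¹≈ε
  •²-neg (suc n) z = C².≈ᴹ-trans (C².+ᴹ-congˡ {C².-ᴹ z} (•²-neg n z)) (⁻¹-∙-comm z (n •² z))

  •²-*ₗ : ∀ n c z → n •² (c C².*ₗ z) C².≈ᴹ c C².*ₗ (n •² z)
  •²-*ₗ zero    c z = C².≈ᴹ-sym (C².*ₗ-zeroʳ c)
  •²-*ₗ (suc n) c z = C².≈ᴹ-trans (C².+ᴹ-congˡ {c C².*ₗ z} (•²-*ₗ n c z))
    (C².≈ᴹ-sym (C².*ₗ-distribˡ c z (n •² z)))

  •²-*ᵣ : ∀ n c z → n •² (z C².*ᵣ c) C².≈ᴹ (n •² z) C².*ᵣ c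
  •²-*ᵣ zero    c z = C².≈ᴹ-sym (C².*ᵣ-zeroˡ c)
  •²-*ᵣ (suc n) c z = C².≈ᴹ-trans (C².+ᴹ-congˡ {z C².*ᵣ c} (•²-*ᵣ n c z))
    (C².≈ᴹ-sym (C².*ᵣ-distribʳ c z (n •² z)))

-- Follows the recursion of `_•²_` and of `_times_`, so that comparisons with them are direct
-- inductions.
fromℕ : ℕ → ℚ
fromℕ zero    = 0ℚ
fromℕ (suc n) = 1ℚ ℚ.+ fromℕ n

fromℕ≥0 : ∀ n → 0ℚ ℚ.≤ fromℕ n
fromℕ≥0 zero    = ℚ.≤-refl
fromℕ≥0 (suc n) = ℚ.+-mono-≤ {0ℚ} {1ℚ} (ℚ.<⇒≤ (ℚ.positive⁻¹ 1ℚ)) (fromℕ≥0 n)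

fromℕ>0 : ∀ n .{{_ : ℕ.NonZero n}} → 0ℚ ℚ.< fromℕ n
fromℕ>0 (suc n) = ℚ.+-mono-<-≤ {0ℚ} {1ℚ} (ℚ.positive⁻¹ 1ℚ) (fromℕ≥0 n)

-- Equality of the representing sequences term by term, for a real coordinate `c`: `_<ᴿ_` is defined
-- through the terms, so bounds can then be scaled without showing it invariant under `_≈ᴿ_`.
•²-seq : (c : ℂ² → ℝ) → (∀ m → seq (c C².0ᴹ) m ≡ 0ℚ) →
  (∀ z w m → seq (c (z C².+ᴹ w)) m ≡ seq (c z) m ℚ.+ seq (c w) m) →
  ∀ n z m → seq (c (n •² z)) m ≡ fromℕ n ℚ.* seq (c z) m
•²-seq c c-0 c-+ zero    z m = ≡.trans (c-0 m) (≡.sym (ℚ.*-zeroˡ (seq (c z) m)))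
•²-seq c c-0 c-+ (suc n) z m = ≡.trans (c-+ z (n •² z) m)
  (≡.trans (≡.cong₂ ℚ._+_ (≡.sym (ℚ.*-identityˡ x)) (•²-seq c c-0 c-+ n z m))
    (≡.sym (ℚ.*-distribʳ-+ x 1ℚ (fromℕ n))))
  where
  x : ℚ
  x = seq (c z) m

module _ (n : ℕ) (z : ℂ²) where
  •²-re₁ : ∀ m → seq (re (proj₁ (n •² z))) m ≡ fromℕ n ℚ.* seq (re (proj₁ z)) m
  •²-re₁ = •²-seq (re ∘ proj₁) (λ _ → ≡.refl) (λ _ _ _ → ≡.refl) n z

  •²-im₁ : ∀ m → seq (im (proj₁ (n •² z))) m ≡ fromℕ n ℚ.* seq (im (proj₁ z)) m
  •²-im₁ = •²-seq (im ∘ proj₁) (λ _ → ≡.refl) (λ _ _ _ → ≡.refl) n z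

  •²-re₂ : ∀ m → seq (re (proj₂ (n •² z))) m ≡ fromℕ n ℚ.* seq (re (proj₂ z)) m
  •²-re₂ = •²-seq (re ∘ proj₂) (λ _ → ≡.refl) (λ _ _ _ → ≡.refl) n z

  •²-im₂ : ∀ m → seq (im (proj₂ (n •² z))) m ≡ fromℕ n ℚ.* seq (im (proj₂ z)) m
  •²-im₂ = •²-seq (im ∘ proj₂) (λ _ → ≡.refl) (λ _ _ _ → ≡.refl) n z

<ᴿ-scale : ∀ {q x y x′ y′} → 0ℚ ℚ.< q → (∀ m → seq x′ m ≡ q ℚ.* seq x m) →
  (∀ m → seq y′ m ≡ q ℚ.* seq y m) → x <ᴿ y → x′ <ᴿ y′
<ᴿ-scale {q} {x} {y} 0<q x′≡ y′≡ (ε , 0<ε , N , h) =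
    q ℚ.* ε , ℚ.positive⁻¹ _ {{ℚ.pos*pos⇒pos q {{ℚ.positive 0<q}} ε {{ℚ.positive 0<ε}}}} , N
  , λ {m} N≤m → ≡.subst₂ ℚ._<_
      (≡.trans (ℚ.*-distribˡ-+ q (seq x m) ε) (≡.cong (ℚ._+ q ℚ.* ε) (≡.sym (x′≡ m))))
      (≡.sym (y′≡ m))
      (ℚ.*-monoʳ-<-pos q {{ℚ.positive 0<q}} (h N≤m))

•²-bounded : ∀ n .{{_ : ℕ.NonZero n}} {ε δ} → fromℕ n ℚ.* δ ≡ ε → ∀ {z} →
  BoundedBy δ z → BoundedBy ε (n •² z)
•²-bounded n {ε} {δ} nδ≡ε {z} (a , b , c , d) =
    scale {re (proj₁ z)} {re (proj₁ (n •² z))} (•²-re₁ n z) a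
  , scale {im (proj₁ z)} {im (proj₁ (n •² z))} (•²-im₁ n z) b
  , scale {re (proj₂ z)} {re (proj₂ (n •² z))} (•²-re₂ n z) c
  , scale {im (proj₂ z)} {im (proj₂ (n •² z))} (•²-im₂ n z) d
  where
  scale : ∀ {x y} → (∀ m → seq y m ≡ fromℕ n ℚ.* seq x m) →
    fromℚ (ℚ.- δ) <ᴿ x × x <ᴿ fromℚ δ → fromℚ (ℚ.- ε) <ᴿ y × y <ᴿ fromℚ ε
  scale {x} {y} y≡ (lower , upper) =
      <ᴿ-scale {fromℕ n} {fromℚ (ℚ.- δ)} {x} {fromℚ (ℚ.- ε)} {y} (fromℕ>0 n)
        (λ _ → ≡.trans (≡.cong ℚ.-_ (≡.sym nδ≡ε)) (ℚ.neg-distribʳ-* (fromℕ n) δ)) y≡ lower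
    , <ᴿ-scale {fromℕ n} {x} {fromℚ δ} {y} {fromℚ ε} (fromℕ>0 n) y≡ (λ _ → ≡.sym nδ≡ε) upper

-- Positivity of a Riemann form is conditional on 0 < ‖z‖², so pulling a form back along
-- multiplication by n has to carry this condition along. The squared norm is homogeneous of degree
-- two, whence the factor n².
•²-norm>0 : ∀ n .{{_ : ℕ.NonZero n}} z → fromℚ 0ℚ <ᴿ ‖ z ‖² → fromℚ 0ℚ <ᴿ ‖ n •² z ‖²
•²-norm>0 n z = <ᴿ-scale {q ℚ.* q} {fromℚ 0ℚ} {‖ z ‖²} {fromℚ 0ℚ} {‖ n •² z ‖²}
  (ℚ.positive⁻¹ _ {{ℚ.pos*pos⇒pos q {{ℚ.positive (fromℕ>0 n)}} q {{ℚ.positive (fromℕ>0 n)}}}})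
  (λ _ → ≡.sym (ℚ.*-zeroʳ (q ℚ.* q)))
  (λ m → ≡.trans
    (≡.cong₂ ℚ._+_ (≡.cong₂ ℚ._+_ (square (•²-re₁ n z m)) (square (•²-im₁ n z m)))
                   (≡.cong₂ ℚ._+_ (square (•²-re₂ n z m)) (square (•²-im₂ n z m))))
    (expand q (seq (re (proj₁ z)) m) (seq (im (proj₁ z)) m) (seq (re (proj₂ z)) m) (seq (im (proj₂ z)) m)))
  where
  q : ℚ
  q = fromℕ n
  square : ∀ {x y} → x ≡ y → x ℚ.* x ≡ y ℚ.* y
  square = ≡.cong (λ x → x ℚ.* x)
  expand : ∀ q a b c d →
    q ℚ.* a ℚ.* (q ℚ.* a) ℚ.+ q ℚ.* b ℚ.* (q ℚ.* b) ℚ.+ (q ℚ.* c ℚ.* (q ℚ.* c) ℚ.+ q ℚ.* d ℚ.* (q ℚ.* d)) ≡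
    q ℚ.* q ℚ.* (a ℚ.* a ℚ.+ b ℚ.* b ℚ.+ (c ℚ.* c ℚ.+ d ℚ.* d))
  expand q a b c d = ≡.trans
    (≡.cong₂ ℚ._+_ (≡.trans (≡.cong₂ ℚ._+_ (factor a) (factor b)) (≡.sym (ℚ.*-distribˡ-+ (q ℚ.* q) _ _)))
                   (≡.trans (≡.cong₂ ℚ._+_ (factor c) (factor d)) (≡.sym (ℚ.*-distribˡ-+ (q ℚ.* q) _ _))))
    (≡.sym (ℚ.*-distribˡ-+ (q ℚ.* q) _ _))
    where
    open CommutativeSemigroupProperties (CommutativeRing.*-commutativeSemigroup ℚ.+-*-commutativeRing) using (interchange)
    factor : ∀ a → q ℚ.* a ℚ.* (q ℚ.* a) ≡ q ℚ.* q ℚ.* (a ℚ.* a)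
    factor a = interchange q a q a

-- Abelian surfaces with a larger lattice

module Enlarge {L L′ : Pred ℂ² 0ℓ} (n : ℕ) .{{_ : ℕ.NonZero n}}
  (nL′⊆L : ∀ {z} → z ∈ L′ → n •² z ∈ L) where

  pullback : RiemannForm L → RiemannForm L′
  pullback form = record
    { H         = λ z w → H (n •² z) (n •² w)
    ; linear    = λ w → Composition.isModuleHomomorphism C.trans
                          (•²-isLinear n) (linear (n •² w))
    ; hermitian = λ z w → hermitian (n •² z) (n •² w)
    ; positive  = λ z 0<‖z‖² → positive (n •² z) (•²-norm>0 n z 0<‖z‖²)
    ; integral  = λ z∈L′ w∈L′ → integral (nL′⊆L z∈L′) (nL′⊆L w∈L′)
    }
    where open RiemannForm form

  -- If the box of radius ε meets L only in 0, the box of radius ε/n meets L′ only in 0: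
  -- multiplication by n sends such a point into L and the larger box, so n kills it, and
  -- `torsionFree` applies. Cocompactness passes to any lattice containing L with the same radius.
  enlarge : IsSubgroup C².+ᴹ-rawGroup L′ → L ⊆ L′ →
    (∀ {z} → z ∈ L′ → n •² z C².≈ᴹ C².0ᴹ → z C².≈ᴹ C².0ᴹ) →
    IsAbelianSurface L → IsAbelianSurface L′
  enlarge L′-subgroup L⊆L′ torsionFree surface = record
    { isSubgroup  = L′-subgroup
    ; discrete    = let ε , 0<ε , isolated = discrete in
        1/n ℚ.* ε
      , ℚ.positive⁻¹ _ {{ℚ.pos*pos⇒pos 1/n {{ℚ.1/pos⇒pos (fromℕ n)}} ε {{ℚ.positive 0<ε}}}}
      , λ {z} z∈L′ small → torsionFree z∈L′
          (isolated (nL′⊆L z∈L′) (•²-bounded n {ε} {1/n ℚ.* ε} (cancel ε) {z} small))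
    ; cocompact   = let r , cover = cocompact in
        r , λ z → let w , w∈L , bounded = cover z in w , L⊆L′ w∈L , bounded
    ; polarizable = pullback polarizable
    }
    where
    open IsAbelianSurface surface
    instance
      n-positive = ℚ.positive (fromℕ>0 n)
      n-nonZero  = ℚ.pos⇒nonZero (fromℕ n)
    1/n : ℚ
    1/n = ℚ.1/ fromℕ n
    cancel : ∀ ε → fromℕ n ℚ.* (1/n ℚ.* ε) ≡ ε
    cancel ε = ≡.trans (≡.sym (ℚ.*-assoc (fromℕ n) 1/n ε))
      (≡.trans (≡.cong (ℚ._* ε) (ℚ.*-inverseʳ (fromℕ n))) (ℚ.*-identityˡ ε))

-- Linear combinations and integers in a field of characteristic zero

-- `k ℚ./ 1` is normalised by a gcd and does not reduce for a variable k, whereas `fromℤ k` is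
-- already in lowest terms, so that the arithmetic of such fractions unfolds.
/1≡fromℤ : ∀ k → k ℚ./ 1 ≡ fromℤ k
/1≡fromℤ k = ℚ.↥p/↧p≡p (fromℤ k)

/1-homo-+ : ∀ j k → (j ℤ.+ k) ℚ./ 1 ≡ j ℚ./ 1 ℚ.+ k ℚ./ 1
/1-homo-+ j k = ≡.trans
  (≡.cong₂ (λ a b → (a ℤ.+ b) ℚ./ 1) (≡.sym (ℤ.*-identityʳ j)) (≡.sym (ℤ.*-identityʳ k)))
  (≡.sym (≡.cong₂ ℚ._+_ (/1≡fromℤ j) (/1≡fromℤ k)))

/1-homo-* : ∀ j k → (j ℤ.* k) ℚ./ 1 ≡ j ℚ./ 1 ℚ.* (k ℚ./ 1)
/1-homo-* j k = ≡.sym (≡.cong₂ ℚ._*_ (/1≡fromℤ j) (/1≡fromℤ k))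

module FieldLemmas (K : CharZeroField) where
  open CharZeroField K hiding (zero)
  open FieldTheory K
  open RawMonoidDefs +-rawMonoid public using (sum) renaming (_×_ to _times_)
  open RawSemiringDefs (RawRing.rawSemiring rawRing) public using (_^_)
  open RingProperties ring public using (-1*x≈-x)
  open AbelianGroupProperties +-abelianGroup public
    using (∙-cancelˡ; x∙y⁻¹≈ε⇒x≈y)
  open SemiringMult semiring public using (×-assoc-*; ×-comm-*; ×-homo-+; ×-congʳ; ×-assocˡ)
  open CommutativeMonoidSum +-commutativeMonoid public
    using (sum-cong-≋; sum-replicate; sum-replicate-zero; ∑-distrib-+; sum-permute)
  open SemiringSum semiring public using (*-distribˡ-sum)
  open NaturalCoefficients commutativeSemiring public using (solve; _:=_; _:+_; _:*_)
  open CommutativeMonoidSolver *-commutativeMonoid public using (_⊜_) renaming (_⊕_ to _⊗_; solve to *-solve)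
  open CommutativeSemigroupProperties +-commutativeSemigroup public using () renaming (interchange to +-interchange)
  module ι = RingMorphisms.IsRingHomomorphism ι-isRingHomomorphism
  open SetoidReasoning setoid

  cancel : ∀ {x y} → ¬ x ≈ 0# → x * y ≈ 0# → y ≈ 0#
  cancel {x} {y} x≉0 xy≈0 with x⁻¹ , xx⁻¹≈1 ← inverse x x≉0 = begin
    y             ≈⟨ *-identityˡ y ⟨
    1# * y        ≈⟨ *-congʳ xx⁻¹≈1 ⟨
    x * x⁻¹ * y   ≈⟨ solve 3 (λ a b c → a :* b :* c := b :* (a :* c)) refl x x⁻¹ y ⟩
    x⁻¹ * (x * y) ≈⟨ *-congˡ xy≈0 ⟩
    x⁻¹ * 0#      ≈⟨ zeroʳ x⁻¹ ⟩
    0#            ∎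

  ι-injective : ∀ q → ι q ≈ 0# → q ≡ 0ℚ
  ι-injective q ιq≈0 with q ℚ.≟ 0ℚ
  ... | yes q≡0 = q≡0
  ... | no  q≢0 = ⊥-elim (0≉1 (begin
    0#                 ≈⟨ zeroˡ _ ⟨
    0# * ι (ℚ.1/ q)    ≈⟨ *-congʳ ιq≈0 ⟨
    ι q * ι (ℚ.1/ q)   ≈⟨ ι.*-homo q (ℚ.1/ q) ⟨
    ι (q ℚ.* ℚ.1/ q)   ≡⟨ ≡.cong ι (ℚ.*-inverseʳ q) ⟩
    ι 1ℚ               ≈⟨ ι.1#-homo ⟩
    1#                 ∎))
    where instance _ = ℚ.≢-nonZero q≢0

  combination-0 : ∀ {n} (c b : Fin n → Carrier) → (∀ i → c i ≈ 0#) → combination c b ≈ 0#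
  combination-0 {n} c b c≈0 = trans
    (sum-cong-≋ (λ i → trans (*-congʳ (c≈0 i)) (zeroˡ (b i)))) (sum-replicate-zero n)

  combination-scale : ∀ {n} x (c b : Fin n → Carrier) →
    x * combination c b ≈ combination (λ i → x * c i) b
  combination-scale {n} x c b = trans (*-distribˡ-sum {n} x (λ i → c i * b i))
    (sum-cong-≋ {n} (λ i → sym (*-assoc x (c i) (b i))))

  combination-+ : ∀ {n} (c d b : Fin n → Carrier) →
    combination c b + combination d b ≈ combination (λ i → c i + d i) b
  combination-+ {n} c d b = trans (sym (∑-distrib-+ {n} (λ i → c i * b i) (λ i → d i * b i)))
    (sum-cong-≋ {n} (λ i → sym (distribʳ (b i) (c i) (d i))))

  -- The coordinates of x in a ℚ-basis are rational, and each can be tested for zero. This is what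
  -- permits assuming x ≉ 0, dividing by x and concluding from a contradiction.
  ≈0-stable : ∀ {n} → HasRank Rational U n → ∀ {x} → ¬ ¬ x ≈ 0# → x ≈ 0#
  ≈0-stable (b , basis) {x} ¬¬x≈0
    with c , rational , x≈ ← IsBasis.spanning basis {x} _ =
    trans x≈ (combination-0 c b c≈0)
    where
    c≈0 : ∀ i → c i ≈ 0#
    c≈0 i with q , ιq≈c ← rational i with q ℚ.≟ 0ℚ
    ... | yes ≡.refl = trans (sym ιq≈c) ι.0#-homo
    ... | no q≢0 = ⊥-elim (¬¬x≈0 λ x≈0 → q≢0 (ι-injective q
      (trans ιq≈c (IsBasis.independent basis c rational (trans (sym x≈) x≈0) i))))

  Integer-respects : Integer Respects _≈_
  Integer-respects x≈y (k , p) = k , trans p x≈y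

  Integer-0# : 0# ∈ Integer
  Integer-0# = ℤ.0ℤ , ι.0#-homo

  Integer-1# : 1# ∈ Integer
  Integer-1# = ℤ.1ℤ , ι.1#-homo

  Integer-+ : ∀ {x y} → x ∈ Integer → y ∈ Integer → x + y ∈ Integer
  Integer-+ (j , p) (k , q) = j ℤ.+ k , (begin
    ι ((j ℤ.+ k) ℚ./ 1)         ≡⟨ ≡.cong ι (/1-homo-+ j k) ⟩
    ι (j ℚ./ 1 ℚ.+ k ℚ./ 1)     ≈⟨ ι.+-homo _ _ ⟩
    ι (j ℚ./ 1) + ι (k ℚ./ 1)   ≈⟨ +-cong p q ⟩
    _                           ∎)

  Integer-* : ∀ {x y} → x ∈ Integer → y ∈ Integer → x * y ∈ Integer
  Integer-* (j , p) (k , q) = j ℤ.* k , (begin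
    ι ((j ℤ.* k) ℚ./ 1)         ≡⟨ ≡.cong ι (/1-homo-* j k) ⟩
    ι (j ℚ./ 1 ℚ.* (k ℚ./ 1))     ≈⟨ ι.*-homo _ _ ⟩
    ι (j ℚ./ 1) * ι (k ℚ./ 1)   ≈⟨ *-cong p q ⟩
    _                           ∎)

  Integer-neg : ∀ {x} → x ∈ Integer → - x ∈ Integer
  Integer-neg {x} p = Integer-respects (-1*x≈-x x)
    (Integer-* (ℤ.-1ℤ , trans (ι.-‿homo 1ℚ) (-‿cong ι.1#-homo)) p)

  -- Integral equations by elimination

  module Polynomials (u : Carrier) where

    -- The values at u of the integral polynomials of degree < n, and of the
    -- monic ones of degree n, in Horner form.
    Lower Monic : ℕ → Subset
    Lower zero    x = x ≈ 0#
    Lower (suc n) x = ∃[ c ] ∃[ y ] (c ∈ Integer × y ∈ Lower n × x ≈ c + u * y)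
    Monic zero    x = x ≈ 1#
    Monic (suc n) x = ∃[ c ] ∃[ y ] (c ∈ Integer × y ∈ Monic n × x ≈ c + u * y)

    Lower-respects : ∀ n → Lower n Respects _≈_
    Lower-respects zero    x≈y p = trans (sym x≈y) p
    Lower-respects (suc n) x≈y (c , z , p , q , r) = c , z , p , q , trans (sym x≈y) r

    Monic-respects : ∀ n → Monic n Respects _≈_
    Monic-respects zero    x≈y p = trans (sym x≈y) p
    Monic-respects (suc n) x≈y (c , z , p , q , r) = c , z , p , q , trans (sym x≈y) r

    Lower-0# : ∀ n → 0# ∈ Lower n
    Lower-0# zero    = refl
    Lower-0# (suc n) = 0# , 0# , Integer-0# , Lower-0# n , sym (trans (+-identityˡ _) (zeroʳ u))

    Lower-Integer : ∀ n → Integer ⊆ Lower (suc n)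
    Lower-Integer n {x} p = x , 0# , p , Lower-0# n , sym (trans (+-congˡ (zeroʳ u)) (+-identityʳ x))

    Lower-suc : ∀ n → Lower n ⊆ Lower (suc n)
    Lower-suc zero    p = Lower-respects 1 (sym p) (Lower-0# 1)
    Lower-suc (suc n) (c , y , p , q , r) = c , y , p , Lower-suc n q , r

    Lower-+ˡ : ∀ m n → Lower n ⊆ Lower (m ℕ.+ n)
    Lower-+ˡ zero    n p = p
    Lower-+ˡ (suc m) n p = Lower-suc (m ℕ.+ n) (Lower-+ˡ m n p)

    private
      regroup : ∀ {x y c d y₁ y₂} → x ≈ c + u * y₁ → y ≈ d + u * y₂ →
        x + y ≈ (c + d) + u * (y₁ + y₂)
      regroup {_} {_} {c} {d} {y₁} {y₂} p q = trans (+-cong p q)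
        (solve 5 (λ u c d y z → c :+ u :* y :+ (d :+ u :* z) := (c :+ d) :+ u :* (y :+ z))
          refl u c d y₁ y₂)

      -- The recursion step of all products below. The summand u y w is itself in Horner form with
      -- constant coefficient zero, which is why `0#` is kept.
      expand : ∀ {x c y w} → x ≈ c + u * y → c * w + (0# + u * (y * w)) ≈ x * w
      expand {_} {c} {y} {w} p = trans (+-congˡ (+-identityˡ _)) (sym (trans (*-congʳ p)
        (solve 4 (λ u c y w → (c :+ u :* y) :* w := c :* w :+ u :* (y :* w)) refl u c y w)))

    Lower-+ : ∀ n {x y} → x ∈ Lower n → y ∈ Lower n → x + y ∈ Lower n
    Lower-+ zero    p q = trans (+-cong p q) (+-identityˡ 0#)
    Lower-+ (suc n) (c , y , p , q , r) (d , z , p′ , q′ , r′) =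
      c + d , y + z , Integer-+ p p′ , Lower-+ n q q′ , regroup r r′

    Monic-+ : ∀ n {x y} → x ∈ Monic n → y ∈ Lower n → x + y ∈ Monic n
    Monic-+ zero    p q = trans (+-cong p q) (+-identityʳ 1#)
    Monic-+ (suc n) (c , y , p , q , r) (d , z , p′ , q′ , r′) =
      c + d , y + z , Integer-+ p p′ , Monic-+ n q q′ , regroup r r′

    Lower-scale : ∀ n {c x} → c ∈ Integer → x ∈ Lower n → c * x ∈ Lower n
    Lower-scale zero    {c} p q = trans (*-congˡ q) (zeroʳ c)
    Lower-scale (suc n) {c} p (d , y , q , r , s) =
      c * d , c * y , Integer-* p q , Lower-scale n p r , trans (*-congˡ s)
        (solve 4 (λ u c d y → c :* (d :+ u :* y) := c :* d :+ u :* (c :* y)) refl u c d y)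

    Lower-neg : ∀ n {x} → x ∈ Lower n → - x ∈ Lower n
    Lower-neg n {x} p = Lower-respects n (-1*x≈-x x) (Lower-scale n (Integer-neg Integer-1#) p)

    Monic⇒Lower : ∀ n → Monic n ⊆ Lower (suc n)
    Monic⇒Lower zero    p = Lower-respects 1 (sym p) (Lower-Integer 0 Integer-1#)
    Monic⇒Lower (suc n) (c , y , p , q , r) = c , y , p , Monic⇒Lower n q , r

    Lower-* : ∀ m n {x y} → x ∈ Lower m → y ∈ Lower n → x * y ∈ Lower (m ℕ.+ n)
    Lower-* zero n {_} {w} p q = Lower-respects n (sym (trans (*-congʳ p) (zeroˡ w))) (Lower-0# n)
    Lower-* (suc m) n (c , y , p , q , r) s = Lower-respects (suc m ℕ.+ n) (expand r)
      (Lower-+ (suc m ℕ.+ n) (Lower-+ˡ (suc m) n (Lower-scale n p s))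
        (0# , _ , Integer-0# , Lower-* m n q s , refl))

    Monic-Lower-* : ∀ m n {x y} → x ∈ Monic m → y ∈ Lower n → x * y ∈ Lower (m ℕ.+ n)
    Monic-Lower-* zero n {_} {w} p q = Lower-respects n (sym (trans (*-congʳ p) (*-identityˡ w))) q
    Monic-Lower-* (suc m) n (c , y , p , q , r) s = Lower-respects (suc m ℕ.+ n) (expand r)
      (Lower-+ (suc m ℕ.+ n) (Lower-+ˡ (suc m) n (Lower-scale n p s))
        (0# , _ , Integer-0# , Monic-Lower-* m n q s , refl))

    Lower-+suc : ∀ m n → Lower (suc n) ⊆ Lower (suc m ℕ.+ n)
    Lower-+suc zero    n p = p
    Lower-+suc (suc m) n p = Lower-suc (suc m ℕ.+ n) (Lower-+suc m n p)

    -- In (c + u y) w the summand c w has degree at most n, below the degree m + 1 + n of u y w, so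
    -- the leading coefficient is untouched; `Lower-+suc` expresses this bound on the degree.
    Monic-* : ∀ m n {x y} → x ∈ Monic m → y ∈ Monic n → x * y ∈ Monic (m ℕ.+ n)
    Monic-* zero n {_} {w} p q = Monic-respects n (sym (trans (*-congʳ p) (*-identityˡ w))) q
    Monic-* (suc m) n (c , y , p , q , r) s =
      Monic-respects (suc m ℕ.+ n) (trans (+-comm _ _) (expand r))
        (Monic-+ (suc m ℕ.+ n) (0# , _ , Integer-0# , Monic-* m n q s , refl)
          (Lower-+suc m n (Lower-scale (suc n) p (Monic⇒Lower n s))))

    private
      unfold : ∀ {n} c (a : Fin n → Carrier) →
        c + u * combination a (λ i → u ^ toℕ i) ≈
        c * 1# + combination a (λ i → u ^ suc (toℕ i))
      unfold {n} c a = +-cong (sym (*-identityʳ c))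
        (trans (*-distribˡ-sum {n} u (λ i → a i * u ^ toℕ i))
          (sum-cong-≋ {n} (λ i → swap (a i) (u ^ toℕ i))))
        where
        swap : ∀ b w → u * (b * w) ≈ b * (u * w)
        swap b w = solve 3 (λ u b w → u :* (b :* w) := b :* (u :* w)) refl u b w

    Monic⇒combination : ∀ n {x} → x ∈ Monic n → ∃ λ (a : Fin n → Carrier) →
      (∀ i → a i ∈ Integer) × u ^ n + combination a (λ i → u ^ toℕ i) ≈ x
    Monic⇒combination zero p = (λ ()) , (λ ()) , trans (+-identityʳ 1#) (sym p)
    Monic⇒combination (suc n) {x} (c , y , p , q , r)
      with a , a∈ℤ , eq ← Monic⇒combination n q = a′ , (λ { zero → p ; (suc i) → a∈ℤ i }) , (begin
        u * u ^ n + (c * 1# + combination a (λ i → u ^ suc (toℕ i)))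
          ≈⟨ +-congˡ (unfold c a) ⟨
        u * u ^ n + (c + u * combination a (λ i → u ^ toℕ i))
          ≈⟨ solve 4 (λ u v c w → u :* v :+ (c :+ u :* w) := c :+ u :* (v :+ w))
               refl u (u ^ n) c (combination a (λ i → u ^ toℕ i)) ⟩
        c + u * (u ^ n + combination a (λ i → u ^ toℕ i))
          ≈⟨ +-congˡ (*-congˡ eq) ⟩
        c + u * y  ≈⟨ r ⟨
        x ∎)
      where
      a′ : Fin (suc n) → Carrier
      a′ zero    = c
      a′ (suc i) = a i

    -- Elimination of v₀ from the system m vᵢ = Σⱼ lᵢⱼ vⱼ: multiply the other
    -- equations by p = m - l₀₀ and substitute p v₀ = Σ_{j>0} l₀ⱼ vⱼ.  The shape
    -- of the system is preserved, with the degree doubled.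
    eliminate : ∀ n d {m} (l : Fin (suc n) → Fin (suc n) → Carrier) v →
      m ∈ Monic d → (∀ i j → l i j ∈ Lower d) → (∀ i → ¬ v i ≈ 0#) →
      (∀ i → m * v i ≈ combination (l i) v) → Integral u
    -- The last equation reads (m - l₀₀) v₀ = 0; as v₀ is nonzero, the monic value m - l₀₀ vanishes.
    eliminate zero d {m} l v m-monic l-lower v≉0 eq
      with a , a∈ℤ , e ← Monic⇒combination d (Monic-+ d m-monic (Lower-neg d (l-lower zero zero))) =
      d , a , a∈ℤ , trans e (cancel (v≉0 zero) (begin
        v zero * (m - l zero zero)                ≈⟨ *-comm _ _ ⟩
        (m - l zero zero) * v zero                ≈⟨ distribʳ _ _ _ ⟩
        m * v zero + - l zero zero * v zero       ≈⟨ +-congʳ (trans (eq zero) (+-identityʳ _)) ⟩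
        l zero zero * v zero + - l zero zero * v zero ≈⟨ distribʳ _ _ _ ⟨
        (l zero zero - l zero zero) * v zero      ≈⟨ *-congʳ (-‿inverseʳ _) ⟩
        0# * v zero                               ≈⟨ zeroˡ _ ⟩
        0#                                        ∎))
    eliminate (suc n) d {m} l v m-monic l-lower v≉0 eq =
      -- The left factor p m is monic of degree 2d while every new coefficient has degree below 2d.
      -- This dominance is what keeps the final equation monic.
      eliminate n (d ℕ.+ d) {p * m} (λ i j → l (suc i) zero * l zero (suc j) + p * l (suc i) (suc j))
        (v ∘ suc)
        (Monic-* d d p-monic m-monic)
        (λ i j → Lower-+ (d ℕ.+ d) (Lower-* d d (l-lower _ _) (l-lower _ _))
                                   (Monic-Lower-* d d p-monic (l-lower _ _)))
        (λ i → v≉0 (suc i))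
        substituted
      where
      p : Carrier
      p = m - l zero zero

      p-monic : p ∈ Monic d
      p-monic = Monic-+ d m-monic (Lower-neg d (l-lower zero zero))

      tail : Fin (suc (suc n)) → Carrier
      tail i = combination (λ j → l i (suc j)) (v ∘ suc)

      p*v₀ : p * v zero ≈ tail zero
      p*v₀ = begin
        (m - l₀) * v zero                ≈⟨ distribʳ _ _ _ ⟩
        m * v zero + - l₀ * v zero       ≈⟨ +-congʳ (eq zero) ⟩
        l₀ * v zero + tail zero + - l₀ * v zero
          ≈⟨ solve 4 (λ a b c d → a :* d :+ b :+ c :* d := (a :+ c) :* d :+ b) refl l₀ (tail zero) (- l₀) (v zero) ⟩
        (l₀ - l₀) * v zero + tail zero   ≈⟨ +-congʳ (trans (*-congʳ (-‿inverseʳ l₀)) (zeroˡ _)) ⟩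
        0# + tail zero                   ≈⟨ +-identityˡ _ ⟩
        tail zero                        ∎
        where l₀ = l zero zero

      substituted : ∀ i → p * m * v (suc i) ≈
        combination (λ j → l (suc i) zero * l zero (suc j) + p * l (suc i) (suc j)) (v ∘ suc)
      substituted i = begin
        p * m * v (suc i)                         ≈⟨ *-assoc _ _ _ ⟩
        p * (m * v (suc i))                       ≈⟨ *-congˡ (eq (suc i)) ⟩
        p * (lᵢ * v zero + tail (suc i))
          ≈⟨ solve 4 (λ p l v t → p :* (l :* v :+ t) := l :* (p :* v) :+ p :* t) refl p lᵢ (v zero) (tail (suc i)) ⟩
        lᵢ * (p * v zero) + p * tail (suc i)      ≈⟨ +-congʳ (*-congˡ p*v₀) ⟩
        lᵢ * tail zero + p * tail (suc i)
          ≈⟨ +-cong (combination-scale lᵢ (λ j → l zero (suc j)) (v ∘ suc))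
                    (combination-scale p (λ j → l (suc i) (suc j)) (v ∘ suc)) ⟩
        combination (λ j → lᵢ * l zero (suc j)) (v ∘ suc) +
          combination (λ j → p * l (suc i) (suc j)) (v ∘ suc)
          ≈⟨ combination-+ (λ j → lᵢ * l zero (suc j)) (λ j → p * l (suc i) (suc j)) (v ∘ suc) ⟩
        _ ∎
        where lᵢ = l (suc i) zero

  -- If bᵢ vanished, the Kronecker coefficients δ would form a relation, and independence would
  -- force 1 = δᵢ = 0.
  basis≉0 : ∀ {n M} {b : Fin n → Carrier} → IsBasis Integer M b → ∀ i → ¬ b i ≈ 0#
  basis≉0 {n} {M} {b} basis i bᵢ≈0 = 0≉1 (trans (sym (independent δ δ∈ℤ vanish i)) δᵢ≈1)
    where
    open IsBasis basis
    δ : Fin n → Carrier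
    δ j with i Fin.≟ j
    ... | yes _ = 1#
    ... | no  _ = 0#
    δᵢ≈1 : δ i ≈ 1#
    δᵢ≈1 with i Fin.≟ i
    ... | yes _ = refl
    ... | no i≢i = ⊥-elim (i≢i ≡.refl)
    δ∈ℤ : ∀ j → δ j ∈ Integer
    δ∈ℤ j with i Fin.≟ j
    ... | yes _ = Integer-1#
    ... | no  _ = Integer-0#
    δ*b≈0 : ∀ j → δ j * b j ≈ 0#
    δ*b≈0 j with i Fin.≟ j
    ... | yes ≡.refl = trans (*-identityˡ _) bᵢ≈0
    ... | no _ = zeroˡ _
    vanish : combination δ b ≈ 0#
    vanish = trans (sum-cong-≋ δ*b≈0) (sum-replicate-zero n)

  finite⇒integral : ∀ {n M} {b : Fin (suc n) → Carrier} → IsBasis Integer M b →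
    ∀ {u} → (∀ i → u * b i ∈ M) → Integral u
  finite⇒integral {n} {M} {b} basis {u} stable =
    eliminate n 1 (λ i → proj₁ (coords i)) b
      -- The initial multiplier is u itself, in Horner form 0 + u · 1, against constant
      -- coefficients: the elimination starts in degree 1.
      (0# , 1# , Integer-0# , refl , sym (trans (+-identityˡ _) (*-identityʳ u)))
      (λ i j → Lower-Integer 0 (proj₁ (proj₂ (coords i)) j))
      (basis≉0 basis) (λ i → proj₂ (proj₂ (coords i)))
    where
    open Polynomials u
    coords = λ i → IsBasis.spanning basis (stable i)

-- Congruences and submodules over 𝒪₀

module Ideals (E : QuarticCMField) where
  open QuarticCMField E hiding (zero)
  open FieldLemmas K public
  open SetoidReasoning setoid

  infix 4 _≡_[mod_]
  -- The additive form keeps subtraction out of the computations and does not require `S` to respect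
  -- equality; `-⇒mod` and `mod⇒-` translate to the differences of the statement.
  _≡_[mod_] : Carrier → Carrier → Subset → Set
  x ≡ y [mod S ] = ∃[ p ] (p ∈ S × x ≈ y + p)

  -⇒mod : ∀ {S x y} → x - y ∈ S → x ≡ y [mod S ]
  -⇒mod {S} {x} {y} p = x - y , p , (begin
    x              ≈⟨ +-identityˡ x ⟨
    0# + x         ≈⟨ +-congʳ (-‿inverseʳ y) ⟨
    (y - y) + x    ≈⟨ solve 3 (λ x y z → (y :+ z) :+ x := y :+ (x :+ z)) refl x y (- y) ⟩
    y + (x - y)    ∎)

  mod⇒- : ∀ {S x y} → S Respects _≈_ → x ≡ y [mod S ] → x - y ∈ S
  mod⇒- {S} {x} {y} respects (p , p∈S , eq) = respects (begin
    p              ≈⟨ +-identityˡ p ⟨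
    0# + p         ≈⟨ +-congʳ (-‿inverseʳ y) ⟨
    (y - y) + p    ≈⟨ solve 3 (λ p y z → (y :+ z) :+ p := (y :+ p) :+ z) refl p y (- y) ⟩
    (y + p) - y    ≈⟨ +-congʳ eq ⟨
    x - y          ∎) p∈S

  -- The part of `IsFractionalIdeal` that still makes sense for Λ and the overlattices, which are
  -- not contained in `K₀`.
  record IsSubmodule (I : Subset) : Set where
    field
      respects : I Respects _≈_
      0#-closed : 0# ∈ I
      +-closed : ∀ {x y} → x ∈ I → y ∈ I → x + y ∈ I
      *-closed : ∀ {r x} → r ∈ 𝒪₀ → x ∈ I → r * x ∈ I

    sum-closed : ∀ {n} (f : Fin n → Carrier) → (∀ i → f i ∈ I) → sum f ∈ I
    sum-closed {zero}  f f∈I = 0#-closed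
    sum-closed {suc n} f f∈I = +-closed (f∈I zero) (sum-closed (f ∘ suc) (f∈I ∘ suc))

    times-closed : ∀ n {x} → x ∈ I → n times x ∈ I
    times-closed zero    x∈I = 0#-closed
    times-closed (suc n) x∈I = +-closed x∈I (times-closed n x∈I)

    -- Negation is multiplication by -1. Membership of -1 in 𝒪₀ is a parameter because 𝒪₀ is not yet
    -- known to be a ring.
    module Congruence (-1∈𝒪₀ : - 1# ∈ 𝒪₀) where

      neg-closed : ∀ {x} → x ∈ I → - x ∈ I
      neg-closed {x} x∈I = respects (-1*x≈-x x) (*-closed -1∈𝒪₀ x∈I)

      mod-reflexive : ∀ {x y} → x ≈ y → x ≡ y [mod I ]
      mod-reflexive x≈y = 0# , 0#-closed , trans x≈y (sym (+-identityʳ _))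

      mod-sym : ∀ {x y} → x ≡ y [mod I ] → y ≡ x [mod I ]
      mod-sym {x} {y} (p , p∈I , eq) = - p , neg-closed p∈I , (begin
        y              ≈⟨ +-identityʳ y ⟨
        y + 0#         ≈⟨ +-congˡ (-‿inverseʳ p) ⟨
        y + (p - p)    ≈⟨ +-assoc y p (- p) ⟨
        (y + p) - p    ≈⟨ +-congʳ eq ⟨
        x - p          ∎)

      mod-trans : ∀ {x y z} → x ≡ y [mod I ] → y ≡ z [mod I ] → x ≡ z [mod I ]
      mod-trans {x} {y} {z} (p , p∈I , eq) (q , q∈I , eq′) = q + p , +-closed q∈I p∈I
        , trans eq (trans (+-congʳ eq′) (+-assoc z q p))

      mod-+ : ∀ {x x′ y y′} → x ≡ x′ [mod I ] → y ≡ y′ [mod I ] → x + y ≡ x′ + y′ [mod I ]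
      mod-+ {x} {x′} {y} {y′} (p , p∈I , eq) (q , q∈I , eq′) = p + q , +-closed p∈I q∈I
        , trans (+-cong eq eq′)
            (solve 4 (λ x p y q → (x :+ p) :+ (y :+ q) := (x :+ y) :+ (p :+ q)) refl x′ p y′ q)

      mod-* : ∀ {r x y} → r ∈ 𝒪₀ → x ≡ y [mod I ] → r * x ≡ r * y [mod I ]
      mod-* {r} r∈𝒪₀ (p , p∈I , eq) = r * p , *-closed r∈𝒪₀ p∈I
        , trans (*-congˡ eq) (distribˡ r _ p)

      mod-times : ∀ n {x y} → x ≡ y [mod I ] → n times x ≡ n times y [mod I ]
      mod-times zero    p = mod-reflexive refl
      mod-times (suc n) p = mod-+ p (mod-times n p)

      mod-closed : ∀ {x y} → x ≡ y [mod I ] → y ∈ I → x ∈ I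
      mod-closed (p , p∈I , eq) y∈I = respects (sym eq) (+-closed y∈I p∈I)

      ∈⇒mod-0 : ∀ {x} → x ∈ I → x ≡ 0# [mod I ]
      ∈⇒mod-0 x∈I = _ , x∈I , sym (+-identityˡ _)

  ideal⇒submodule : ∀ {I} → IsFractionalIdeal I → IsSubmodule I
  ideal⇒submodule ideal = record { IsFractionalIdeal ideal }

  -- A sum Σ γcᵢbᵢ collapses to γ Σ cᵢbᵢ, and one summand suffices for the converse. All ideal
  -- products below become multiplications by a generator in this way.
  principal-· : ∀ {I J γ} → I ≐ γ • 𝒪₀ → 1# ∈ 𝒪₀ → IsSubmodule J → I · J ≐ γ • J
  principal-· {I} {J} {γ} (I⊆ , ⊇I) 1∈𝒪₀ J-submodule = to , from
    where
    open IsSubmodule J-submodule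
    to : I · J ⊆ γ • J
    to {x} (n , a , b , a∈I , b∈J , x≈) = combination c b
      , sum-closed (λ i → c i * b i) (λ i → *-closed (proj₁ (proj₂ (I⊆ (a∈I i)))) (b∈J i))
      , (begin
        x                             ≈⟨ x≈ ⟩
        combination a b               ≈⟨ sum-cong-≋ {n} (λ i → *-congʳ (proj₂ (proj₂ (I⊆ (a∈I i))))) ⟩
        combination (λ i → γ * c i) b ≈⟨ combination-scale γ c b ⟨
        γ * combination c b           ∎)
      where
      c : Fin n → Carrier
      c i = proj₁ (I⊆ (a∈I i))
    from : γ • J ⊆ I · J
    from (y , y∈J , x≈) = 1 , (λ _ → γ) , (λ _ → y)
      , (λ _ → ⊇I (1# , 1∈𝒪₀ , sym (*-identityʳ γ))) , (λ _ → y∈J) , trans x≈ (sym (+-identityʳ _))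

-- The ring 𝒪₀ and its principal ideals

module Orders (E : QuarticCMField) where
  open QuarticCMField E hiding (zero)
  open Ideals E public
  open SetoidReasoning setoid

  order⇒integral : ∀ {𝒪} → IsOrder 𝒪 → 𝒪 ⊆ Integral
  order⇒integral 𝒪-order {u} u∈𝒪 with b , basis ← IsOrder.ℤ-rank 𝒪-order =
    finite⇒integral basis (λ i → *-closed u∈𝒪 (IsBasis.elements basis i))
    where open IsSubring (IsOrder.isSubring 𝒪-order)

  module _ {𝒪} (𝒪-order : IsOrder 𝒪) (𝒪₀⊆𝒪 : 𝒪₀ ⊆ 𝒪) where
    private
      module K₀ = IsSubfield K₀-isSubfield
      module 𝒪 = IsSubring (IsOrder.isSubring 𝒪-order)

      build : ∀ {x} → x ∈ K₀ → x ∈ 𝒪 → x ∈ 𝒪₀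
      build p q = p , order⇒integral 𝒪-order q

    -- Elements of 𝒪 are integral and 𝒪₀ ⊆ 𝒪, so 𝒪₀ = K₀ ∩ 𝒪 is an intersection of two rings. No
    -- general closure of integral elements under sums and products is required.
    𝒪₀-isSubring : IsSubring 𝒪₀
    𝒪₀-isSubring = record
      { respects  = λ x≈y p → build (K₀.respects x≈y (proj₁ p)) (𝒪.respects x≈y (𝒪₀⊆𝒪 p))
      ; 0#-closed = build K₀.0#-closed 𝒪.0#-closed
      ; 1#-closed = build K₀.1#-closed 𝒪.1#-closed
      ; +-closed  = λ p q → build (K₀.+-closed (proj₁ p) (proj₁ q)) (𝒪.+-closed (𝒪₀⊆𝒪 p) (𝒪₀⊆𝒪 q))
      ; *-closed  = λ p q → build (K₀.*-closed (proj₁ p) (proj₁ q)) (𝒪.*-closed (𝒪₀⊆𝒪 p) (𝒪₀⊆𝒪 q))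
      ; -‿closed  = λ p → build (K₀.-‿closed (proj₁ p)) (𝒪.-‿closed (𝒪₀⊆𝒪 p))
      }

  record Generator (I : Subset) : Set where
    field
      γ γ⁻¹    : Carrier
      γ∈K₀     : γ ∈ K₀
      γ⁻¹∈K₀   : γ⁻¹ ∈ K₀
      γγ⁻¹≈1   : γ * γ⁻¹ ≈ 1#
      generates : I ≐ γ • 𝒪₀

  module Principal (𝒪₀-isSubring : IsSubring 𝒪₀) where
    open IsSubring 𝒪₀-isSubring
    private module K₀ = IsSubfield K₀-isSubfield

    𝒪₀-isFractionalIdeal : IsFractionalIdeal 𝒪₀
    𝒪₀-isFractionalIdeal = record
      { respects          = respects
      ; contained         = proj₁
      ; 0#-closed         = 0#-closed
      ; +-closed          = +-closed
      ; *-closed          = *-closed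
      ; nonzero           = 1# , 1#-closed , 0≉1 ∘ sym
      ; finitelyGenerated = 1 , (λ _ → 1#) , (λ _ → 1#-closed) , λ {x} x∈𝒪₀ →
          (λ _ → x) , (λ _ → x∈𝒪₀) , sym (trans (+-identityʳ _) (*-identityʳ x))
      }

    -- The only class is represented by an unspecified ideal J. Surjectivity at I and at 𝒪₀ gives J
    -- = αI and J = β𝒪₀, hence I = βα⁻¹𝒪₀.
    principal : K₀-HasClassNumber 1 → ∀ {I} → IsFractionalIdeal I → Generator I
    principal (only , _ , _ , surjective) {I} I-ideal
      with surjective (I , I-ideal) | surjective (𝒪₀ , 𝒪₀-isFractionalIdeal)
    ... | zero , same | zero , same₀
      with α , α∈K₀ , α≉0 , J⊆αI , αI⊆J ← same ≡.refl
         | β , β∈K₀ , β≉0 , J⊆βO , βO⊆J ← same₀ ≡.refl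
      with α⁻¹ , αα⁻¹≈1 ← inverse α α≉0 | β⁻¹ , ββ⁻¹≈1 ← inverse β β≉0 = record
      { γ         = β * α⁻¹
      ; γ⁻¹       = α * β⁻¹
      ; γ∈K₀      = K₀.*-closed β∈K₀ (K₀.inverse-closed α∈K₀ αα⁻¹≈1)
      ; γ⁻¹∈K₀    = K₀.*-closed α∈K₀ (K₀.inverse-closed β∈K₀ ββ⁻¹≈1)
      ; γγ⁻¹≈1    = begin
          β * α⁻¹ * (α * β⁻¹)    ≈⟨ solve 4 (λ a a′ b b′ → b :* a′ :* (a :* b′) := (a :* a′) :* (b :* b′)) refl α α⁻¹ β β⁻¹ ⟩
          (α * α⁻¹) * (β * β⁻¹)  ≈⟨ *-cong αα⁻¹≈1 ββ⁻¹≈1 ⟩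
          1# * 1#                ≈⟨ *-identityˡ 1# ⟩
          1#                     ∎
      ; generates = to , from
      }
      where
      divide : ∀ {x y z} → α * x ≈ β * y → z ≈ β * α⁻¹ * y → x ≈ z
      divide {x} {y} {z} eq eq′ = begin
        x               ≈⟨ *-identityˡ x ⟨
        1# * x          ≈⟨ *-congʳ αα⁻¹≈1 ⟨
        α * α⁻¹ * x     ≈⟨ solve 3 (λ a b c → a :* b :* c := b :* (a :* c)) refl α α⁻¹ x ⟩
        α⁻¹ * (α * x)   ≈⟨ *-congˡ eq ⟩
        α⁻¹ * (β * y)   ≈⟨ solve 3 (λ a b c → a :* (b :* c) := b :* a :* c) refl α⁻¹ β y ⟩
        β * α⁻¹ * y     ≈⟨ eq′ ⟨
        z               ∎
      to : I ⊆ (β * α⁻¹) • 𝒪₀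
      to {x} x∈I with r , r∈𝒪₀ , eq ← J⊆βO (αI⊆J (x , x∈I , refl)) =
        r , r∈𝒪₀ , divide eq refl
      from : (β * α⁻¹) • 𝒪₀ ⊆ I
      from (r , r∈𝒪₀ , eq) with x , x∈I , eq′ ← J⊆αI (βO⊆J (r , r∈𝒪₀ , refl)) =
        IsFractionalIdeal.respects I-ideal (divide (sym eq′) eq) x∈I

    -- The residue classes modulo 𝔩

    module Residues (ℓ : ℕ) (ℓ-prime : Prime ℓ)
                    (𝔩 : Subset) (𝔩-prime : IsPrimeIdeal 𝔩) (norm : HasNorm 𝔩 ℓ) where
      open IsPrimeIdeal 𝔩-prime renaming (isFractionalIdeal to 𝔩-ideal)
      private module 𝔩 = IsSubmodule (ideal⇒submodule 𝔩-ideal)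

      residue : Fin ℓ → Σ Carrier 𝒪₀
      residue = proj₁ norm

      residue-injective : ∀ {i j} → proj₁ (residue i) - proj₁ (residue j) ∈ 𝔩 → i ≡ j
      residue-injective = proj₁ (proj₂ (proj₂ norm))

      -- A priori the number depends on the proof of `x ∈ 𝒪₀`; `index-cong` shows that only the
      -- class of x matters.
      index : ∀ {x} → x ∈ 𝒪₀ → Fin ℓ
      index x∈𝒪₀ = proj₁ (proj₂ (proj₂ (proj₂ norm)) (_ , x∈𝒪₀))

      residue-index : ∀ {x} (x∈𝒪₀ : x ∈ 𝒪₀) → proj₁ (residue (index x∈𝒪₀)) - x ∈ 𝔩
      residue-index x∈𝒪₀ = proj₂ (proj₂ (proj₂ (proj₂ norm)) (_ , x∈𝒪₀)) ≡.refl

      -1∈𝒪₀ : - 1# ∈ 𝒪₀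
      -1∈𝒪₀ = -‿closed 1#-closed

      open 𝔩.Congruence -1∈𝒪₀ public

      index-≡ : ∀ {x} (p : x ∈ 𝒪₀) → proj₁ (residue (index p)) ≡ x [mod 𝔩 ]
      index-≡ p = -⇒mod (residue-index p)

      index-reflects : ∀ {x y} (p : x ∈ 𝒪₀) (q : y ∈ 𝒪₀) → index p ≡ index q → x ≡ y [mod 𝔩 ]
      index-reflects {x} p q eq = mod-trans (mod-sym (index-≡ p))
        (≡.subst (λ i → proj₁ (residue i) ≡ _ [mod 𝔩 ]) (≡.sym eq) (index-≡ q))

      index-cong : ∀ {x y} (p : x ∈ 𝒪₀) (q : y ∈ 𝒪₀) → x ≡ y [mod 𝔩 ] → index p ≡ index q
      index-cong p q x≡y = residue-injective
        (mod⇒- 𝔩.respects (mod-trans (index-≡ p) (mod-trans x≡y (mod-sym (index-≡ q)))))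

      -- Class numbers lie in `Fin ℓ`, so the class of x can be compared with that of 0.
      _∈𝔩? : ∀ {x} → x ∈ 𝒪₀ → Dec (x ∈ 𝔩)
      p ∈𝔩? with index p Fin.≟ index 0#-closed
      ... | yes eq = yes (mod-closed (index-reflects p 0#-closed eq) 𝔩.0#-closed)
      ... | no neq = no λ x∈𝔩 → neq (index-cong p 0#-closed (∈⇒mod-0 x∈𝔩))

      -- x ↦ x + 1 permutes the residues, so their sum does not change when
      -- 1 is added to each of them.
      ℓ∈𝔩 : ℓ times 1# ∈ 𝔩
      -- With p i ∈ 𝔩 the discrepancy between r i + 1 and r (σ i), cancelling Σ r identifies ℓ · 1
      -- with Σ p.
      ℓ∈𝔩 = 𝔩.respects (∙-cancelˡ (sum r) _ _ (begin
          sum r + sum p              ≈⟨ +-congʳ (sum-permute r π) ⟩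
          sum (λ i → r (σ i)) + sum p  ≈⟨ ∑-distrib-+ (λ i → r (σ i)) p ⟨
          sum (λ i → r (σ i) + p i)  ≈⟨ sum-cong-≋ {ℓ} (λ i → proj₂ (proj₂ (shifted i))) ⟨
          sum (λ i → r i + 1#)       ≈⟨ ∑-distrib-+ r (λ _ → 1#) ⟩
          sum r + sum (λ (i : Fin ℓ) → 1#) ≈⟨ +-congˡ (sum-replicate ℓ) ⟩
          sum r + ℓ times 1#         ∎))
        (𝔩.sum-closed p (λ i → proj₁ (proj₂ (shifted i))))
        where
        r : Fin ℓ → Carrier
        r i = proj₁ (residue i)

        r∈ : ∀ i → r i ∈ 𝒪₀
        r∈ i = proj₂ (residue i)

        shift : ∀ {c} → c ∈ 𝒪₀ → Fin ℓ → Fin ℓ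
        shift c∈𝒪₀ i = index (+-closed (r∈ i) c∈𝒪₀)

        σ : Fin ℓ → Fin ℓ
        σ = shift 1#-closed

        shifted : ∀ i → r i + 1# ≡ r (σ i) [mod 𝔩 ]
        shifted i = mod-sym (index-≡ (+-closed (r∈ i) 1#-closed))

        unshift : ∀ {c d} (p : c ∈ 𝒪₀) (q : d ∈ 𝒪₀) → d + c ≈ 0# → ∀ i → shift p (shift q i) ≡ i
        unshift {c} {d} p q d+c≈0 i = residue-injective (mod⇒- 𝔩.respects
          (mod-trans (index-≡ (+-closed (r∈ (shift q i)) p))
            (mod-trans (mod-+ (index-≡ (+-closed (r∈ i) q)) (mod-reflexive refl))
              (mod-reflexive (trans (+-assoc (r i) d c) (trans (+-congˡ d+c≈0) (+-identityʳ (r i))))))))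

        π : Permutation.Permutation ℓ ℓ
        π = Permutation.permutation σ (shift -1∈𝒪₀)
          (unshift 1#-closed -1∈𝒪₀ (-‿inverseˡ 1#)) (unshift -1∈𝒪₀ 1#-closed (-‿inverseʳ 1#))

        p : Fin ℓ → Carrier
        p i = proj₁ (shifted i)

      -- A Bézout relation between m and ℓ would put 1 into 𝔩. It is given with natural
      -- coefficients, as 1 + y n = x m with either number in the role of m, so `combine` is applied
      -- in both orders.
      times-coprime : ∀ {m} → Coprime m ℓ → m times 1# ∈ 𝔩 → ⊥
      times-coprime {m} coprime m∈𝔩 = case coprime-Bézout coprime of λ where
          (Bézout.+- x y eq) → proper (combine m∈𝔩 ℓ∈𝔩 x y eq)
          (Bézout.-+ x y eq) → proper (combine ℓ∈𝔩 m∈𝔩 y x eq)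
        where
        combine : ∀ {m n} → m times 1# ∈ 𝔩 → n times 1# ∈ 𝔩 → ∀ x y → 1 ℕ.+ y ℕ.* n ≡ x ℕ.* m → 1# ∈ 𝔩
        combine {m} {n} m∈𝔩 n∈𝔩 x y eq = mod-closed
          (mod-sym ((y ℕ.* n) times 1# , multiple y n n∈𝔩 , reflexive (≡.cong (_times 1#) (≡.sym eq))))
          (multiple x m m∈𝔩)
          where
          multiple : ∀ x m → m times 1# ∈ 𝔩 → (x ℕ.* m) times 1# ∈ 𝔩
          multiple x m m∈𝔩 = 𝔩.respects (×-assocˡ 1# x m) (𝔩.times-closed x m∈𝔩)

      times∈𝒪₀ : ∀ n {x} → x ∈ 𝒪₀ → n times x ∈ 𝒪₀
      times∈𝒪₀ = IsSubmodule.times-closed (ideal⇒submodule 𝒪₀-isFractionalIdeal)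

      -- Otherwise ((j - i) · 1) a would lie in 𝔩. Since 𝔩 is prime and a ∉ 𝔩, the first factor
      -- would lie in 𝔩, but 0 < j - i < ℓ is coprime to ℓ.
      times-distinct : ∀ {a} → a ∈ 𝒪₀ → a ∉ 𝔩 → ∀ {i j} → i ℕ.< j → j ℕ.< ℓ →
        ¬ j times a ≡ i times a [mod 𝔩 ]
      times-distinct {a} a∈𝒪₀ a∉𝔩 {i} {j} i<j j<ℓ (p , p∈𝔩 , eq) =
        case prime (times∈𝒪₀ k 1#-closed) a∈𝒪₀ (𝔩.respects (begin
          p                   ≈⟨ ∙-cancelˡ (i times a) _ _ k+i ⟨
          k times a           ≈⟨ ×-congʳ k (*-identityˡ a) ⟨
          k times (1# * a)    ≈⟨ ×-assoc-* k 1# a ⟨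
          k times 1# * a      ∎) p∈𝔩) of λ where
            (inj₁ k∈𝔩) → times-coprime (Coprimality.sym (Coprimality.prime⇒coprime ℓ-prime
              {{ℕ.>-nonZero (ℕ.m<n⇒0<n∸m i<j)}} (ℕ.≤-<-trans (ℕ.m∸n≤m j i) j<ℓ))) k∈𝔩
            (inj₂ a∈𝔩) → a∉𝔩 a∈𝔩
        where
        k : ℕ
        k = j ℕ.∸ i
        k+i : i times a + k times a ≈ i times a + p
        k+i = begin
          i times a + k times a   ≈⟨ ×-homo-+ a i k ⟨
          (i ℕ.+ k) times a       ≡⟨ ≡.cong (_times a) (ℕ.m+[n∸m]≡n (ℕ.<⇒≤ i<j)) ⟩
          j times a               ≈⟨ eq ⟩
          i times a + p           ∎

      times-injective : ∀ {a} → a ∈ 𝒪₀ → a ∉ 𝔩 → ∀ {i j : Fin ℓ} →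
        toℕ i times a ≡ toℕ j times a [mod 𝔩 ] → i ≡ j
      times-injective a∈𝒪₀ a∉𝔩 {i} {j} eq with Fin.<-cmp i j
      ... | tri< i<j _ _ = ⊥-elim (times-distinct a∈𝒪₀ a∉𝔩 i<j (Fin.toℕ<n j) (mod-sym eq))
      ... | tri≈ _ i≡j _ = i≡j
      ... | tri> _ _ j<i = ⊥-elim (times-distinct a∈𝒪₀ a∉𝔩 j<i (Fin.toℕ<n i) eq)

      -- If the search through the ℓ multiples of a missed the class of y, these multiples together
      -- with y would be ℓ + 1 elements in distinct classes, one more than there are. With y = 1
      -- this inverts a modulo 𝔩.
      times-surjective : ∀ {a} → a ∈ 𝒪₀ → a ∉ 𝔩 → ∀ {y} → y ∈ 𝒪₀ →
        ∃[ i ] y ≡ toℕ {ℓ} i times a [mod 𝔩 ]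
      times-surjective {a} a∈𝒪₀ a∉𝔩 {y} y∈𝒪₀ with Fin.any? (λ i → index y∈𝒪₀ Fin.≟ index (times∈𝒪₀ (toℕ i) a∈𝒪₀))
      ... | yes (i , eq) = i , index-reflects y∈𝒪₀ (times∈𝒪₀ (toℕ i) a∈𝒪₀) eq
      ... | no missed = ⊥-elim (collision (Fin.pigeonhole (ℕ.n<1+n ℓ) f))
        where
        f : Fin (suc ℓ) → Fin ℓ
        f zero    = index y∈𝒪₀
        f (suc i) = index (times∈𝒪₀ (toℕ i) a∈𝒪₀)
        collision : ¬ (∃[ i ] ∃[ j ] (toℕ i ℕ.< toℕ j × f i ≡ f j))
        collision (zero  , suc j , _   , eq) = missed (j , eq)
        collision (suc i , suc j , i<j , eq) = ℕ.<⇒≢ (ℕ.s<s⁻¹ i<j) (≡.cong toℕ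
          (times-injective a∈𝒪₀ a∉𝔩 (index-reflects (times∈𝒪₀ (toℕ i) a∈𝒪₀) (times∈𝒪₀ (toℕ j) a∈𝒪₀) eq)))

0≉1ᶜ : ¬ C.0# C.≈ C.1#
0≉1ᶜ 0≈1 with N , h ← close (re≈ 0≈1) 1ℚ (ℚ.positive⁻¹ 1ℚ) = ℚ.<-irrefl ≡.refl (h ℕ.≤-refl ℕ.≤-refl)

-- Absence of torsion, and the images of subsets of K in ℂ²

module Multiplication (K : CharZeroField) where
  open CharZeroField K hiding (zero)
  open FieldLemmas K

  ι-fromℕ : ∀ n → ι (fromℕ n) ≈ n times 1#
  ι-fromℕ zero    = ι.0#-homo
  ι-fromℕ (suc n) = trans (ι.+-homo 1ℚ (fromℕ n)) (+-cong ι.1#-homo (ι-fromℕ n))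

  times-torsionFree : ∀ n .{{_ : ℕ.NonZero n}} {x} → n times x ≈ 0# → x ≈ 0#
  times-torsionFree n {x} nx≈0 = cancel {n times 1#}
    (λ n≈0 → ℚ.<-irrefl (≡.sym (ι-injective (fromℕ n) (trans (ι-fromℕ n) n≈0))) (fromℕ>0 n))
    (trans (×-assoc-* n 1# x) (trans (×-congʳ n (*-identityˡ x)) nx≈0))

module Images (E : QuarticCMField) (type : QuarticCMField.CMType E) where
  open QuarticCMField E hiding (zero)
  open CMType type
  open Ideals E
  private
    module φ₁ = RingMorphisms.IsRingHomomorphism (Embedding.isRingHomomorphism φ₁)
    module φ₂ = RingMorphisms.IsRingHomomorphism (Embedding.isRingHomomorphism φ₂)

  Φ-cong : ∀ {x y} → x ≈ y → Φ x C².≈ᴹ Φ y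
  Φ-cong x≈y = φ₁.⟦⟧-cong x≈y , φ₂.⟦⟧-cong x≈y

  Φ-+ : ∀ x y → Φ (x + y) C².≈ᴹ Φ x C².+ᴹ Φ y
  Φ-+ x y = φ₁.+-homo x y , φ₂.+-homo x y

  Φ-neg : ∀ x → Φ (- x) C².≈ᴹ C².-ᴹ Φ x
  Φ-neg x = φ₁.-‿homo x , φ₂.-‿homo x

  Φ-0# : Φ 0# C².≈ᴹ C².0ᴹ
  Φ-0# = φ₁.0#-homo , φ₂.0#-homo

  Φ-sub : ∀ x y → Φ (x - y) C².≈ᴹ Φ x -² Φ y
  Φ-sub x y = C².≈ᴹ-trans (Φ-+ x (- y)) (C².+ᴹ-congˡ {Φ x} (Φ-neg y))

  Φ-times : ∀ n x → Φ (n times x) C².≈ᴹ n •² Φ x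
  Φ-times zero    x = Φ-0#
  Φ-times (suc n) x = C².≈ᴹ-trans (Φ-+ x (n times x)) (C².+ᴹ-congˡ {Φ x} (Φ-times n x))

  Φ-power : ∀ L n x → Φ (n times x) C².≈ᴹ power (Torus L) (Φ x) (ℤ.+ n)
  Φ-power L zero    x = Φ-0#
  Φ-power L (suc n) x = C².≈ᴹ-trans (Φ-+ x (n times x)) (C².+ᴹ-congˡ {Φ x} (Φ-power L n x))

  -- An inverse of x would be mapped by the first embedding to an inverse of 0 in ℂ. This gives only
  -- ¬¬ x ≈ 0, which `≈0-stable` strengthens.
  Φ≈0⇒≈0 : ∀ {x} → Φ x C².≈ᴹ C².0ᴹ → x ≈ 0#
  Φ≈0⇒≈0 {x} (p , _) = ≈0-stable [K:ℚ]≡4 λ x≉0 → case inverse x x≉0 of λ (y , xy≈1) →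
    0≉1ᶜ (C.trans (C.sym (C.zeroˡ ⟦ y ⟧₁)) (C.trans (C.*-congʳ {⟦ y ⟧₁} (C.sym p))
      (C.trans (C.sym (φ₁.*-homo x y)) (C.trans (φ₁.⟦⟧-cong xy≈1) φ₁.1#-homo))))

  Φ-injective : ∀ {x y} → Φ x C².≈ᴹ Φ y → x ≈ y
  Φ-injective {x} {y} eq = x∙y⁻¹≈ε⇒x≈y x y (Φ≈0⇒≈0 (C².≈ᴹ-trans (Φ-sub x y)
    (C².≈ᴹ-trans (C².+ᴹ-congʳ {C².-ᴹ Φ y} eq) (C².-ᴹ‿inverseʳ (Φ y)))))

  image : ∀ {S x} → x ∈ S → Φ x ∈ Φ[ S ]
  image x∈S = _ , x∈S , C².≈ᴹ-refl

  image⁻¹ : ∀ {S} → IsSubmodule S → ∀ {x} → Φ x ∈ Φ[ S ] → x ∈ S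
  image⁻¹ S-submodule (y , y∈S , eq) = IsSubmodule.respects S-submodule (Φ-injective eq) y∈S

  image-⊆ : ∀ {S T} → S ⊆ T → Φ[ S ] ⊆ Φ[ T ]
  image-⊆ S⊆T (x , x∈S , eq) = x , S⊆T x∈S , eq

  image-mod : ∀ {S x y} → x ≡ y [mod S ] → Φ x -² Φ y ∈ Φ[ S ]
  image-mod {S} {x} {y} (p , p∈S , eq) = p , p∈S , C².≈ᴹ-trans (Φ-cong p≈) (Φ-sub x y)
    where
    p≈ : p ≈ x - y
    p≈ = ∙-cancelˡ y p (x - y) (trans (sym eq) (proj₂ (proj₂ (-⇒mod {U} _))))

  image-mod⁻¹ : ∀ {S} → IsSubmodule S → ∀ {x y} → Φ x -² Φ y ∈ Φ[ S ] → x ≡ y [mod S ]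
  image-mod⁻¹ S-submodule {x} {y} (p , p∈S , eq) =
    -⇒mod (image⁻¹ S-submodule (p , p∈S , C².≈ᴹ-trans eq (C².≈ᴹ-sym (Φ-sub x y))))

  image-subgroup : ∀ {S} → - 1# ∈ 𝒪₀ → IsSubmodule S → IsSubgroup C².+ᴹ-rawGroup Φ[ S ]
  image-subgroup -1∈𝒪₀ S-submodule = record
    { respects  = λ z≈w (x , x∈S , eq) → x , x∈S , C².≈ᴹ-trans eq z≈w
    ; ε-closed  = 0# , S.0#-closed , Φ-0#
    ; ∙-closed  = λ (x , x∈S , eq) (y , y∈S , eq′) →
        x + y , S.+-closed x∈S y∈S , C².≈ᴹ-trans (Φ-+ x y) (C².+ᴹ-cong eq eq′)
    ; ⁻¹-closed = λ (x , x∈S , eq) →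
        - x , S.Congruence.neg-closed -1∈𝒪₀ x∈S , C².≈ᴹ-trans (Φ-neg x) (C².-ᴹ‿cong eq)
    }
    where module S = IsSubmodule S-submodule

-- The plane 𝔩⁻¹Λ/Λ in coordinates

module Lattices (E : QuarticCMField) where
  open QuarticCMField E hiding (zero)
  open Orders E

  module Coordinates
    (𝒪₀-isSubring : IsSubring 𝒪₀)
    (ℓ : ℕ) (ℓ-prime : Prime ℓ)
    (𝔩 : Subset) (𝔩-prime : IsPrimeIdeal 𝔩) (norm : HasNorm 𝔩 ℓ)
    (Λ₁ Λ₂ : Subset) (Λ₁-ideal : IsFractionalIdeal Λ₁) (Λ₂-ideal : IsFractionalIdeal Λ₂)
    (τ : Carrier) (τ∉K₀ : τ ∉ K₀)
    (𝔩-generator : Generator 𝔩) (Λ₁-generator : Generator Λ₁) (Λ₂-generator : Generator Λ₂)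
    where

    open Principal 𝒪₀-isSubring
    open Residues ℓ ℓ-prime 𝔩 𝔩-prime norm public
    open IsSubring 𝒪₀-isSubring
    open Isogenies 𝔩 Λ₁ Λ₂ τ
    open SetoidReasoning setoid
    open Generator 𝔩-generator using () renaming (γ to π; γ⁻¹ to π⁻¹)
    open Generator Λ₁-generator using () renaming (γ to α; γ⁻¹ to α⁻¹)
    open Generator Λ₂-generator using () renaming (γ to β; γ⁻¹ to β⁻¹)
    private
      module K₀ = IsSubfield K₀-isSubfield
      module 𝔩 = IsSubmodule (ideal⇒submodule (IsPrimeIdeal.isFractionalIdeal 𝔩-prime))
      module π = Generator 𝔩-generator
      module α = Generator Λ₁-generator
      module β = Generator Λ₂-generator

    Λ : Subset
    Λ = Λ₁ ⊕ τ • Λ₂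

    -- Because π is divided out, 𝔩⁻¹Λ consists of the points with coordinates in 𝒪₀ and Λ of those
    -- with coordinates in 𝔩; see `M≐` and `Λ≐`.
    e₁ e₂ : Carrier
    e₁ = π⁻¹ * α
    e₂ = π⁻¹ * (τ * β)

    point : Carrier → Carrier → Carrier
    point a b = a * e₁ + b * e₂

    point-cong : ∀ {a a′ b b′} → a ≈ a′ → b ≈ b′ → point a b ≈ point a′ b′
    point-cong a≈a′ b≈b′ = +-cong (*-congʳ a≈a′) (*-congʳ b≈b′)

    point-+ : ∀ a b c d → point a b + point c d ≈ point (a + c) (b + d)
    point-+ a b c d = trans (+-interchange (a * e₁) (b * e₂) (c * e₁) (d * e₂))
      (sym (+-cong (distribʳ e₁ a c) (distribʳ e₂ b d)))

    point-* : ∀ r a b → r * point a b ≈ point (r * a) (r * b)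
    point-* r a b = trans (distribˡ r (a * e₁) (b * e₂))
      (sym (+-cong (*-assoc r a e₁) (*-assoc r b e₂)))

    point-0# : point 0# 0# ≈ 0#
    point-0# = trans (+-cong (zeroˡ e₁) (zeroˡ e₂)) (+-identityˡ 0#)

    point-times : ∀ n a b → n times point a b ≈ point (n times a) (n times b)
    point-times zero    a b = sym point-0#
    point-times (suc n) a b = trans (+-congˡ (point-times n a b)) (point-+ a b (n times a) (n times b))

    insert : ∀ {x x⁻¹} y → x * x⁻¹ ≈ 1# → y ≈ x * x⁻¹ * y
    insert y xx⁻¹≈1 = sym (trans (*-congʳ xx⁻¹≈1) (*-identityˡ y))

    clear-e₁ : ∀ r → π * r * e₁ ≈ α * r
    clear-e₁ r = trans
      (*-solve 4 (λ p q a r → (p ⊗ r) ⊗ (q ⊗ a) ⊜ (p ⊗ q) ⊗ (a ⊗ r)) refl π π⁻¹ α r)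
      (sym (insert (α * r) π.γγ⁻¹≈1))

    clear-e₂ : ∀ s → π * s * e₂ ≈ τ * (β * s)
    clear-e₂ s = trans
      (*-solve 5 (λ p q t b s → (p ⊗ s) ⊗ (q ⊗ (t ⊗ b)) ⊜ (p ⊗ q) ⊗ (t ⊗ (b ⊗ s))) refl π π⁻¹ τ β s)
      (sym (insert (τ * (β * s)) π.γγ⁻¹≈1))

    unit-cancel : ∀ {x x⁻¹ y} → x * x⁻¹ ≈ 1# → x * y ≈ 0# → y ≈ 0#
    unit-cancel {x} {x⁻¹} {y} xx⁻¹≈1 xy≈0 = begin
      y               ≈⟨ insert y xx⁻¹≈1 ⟩
      x * x⁻¹ * y     ≈⟨ *-solve 3 (λ x x′ y → (x ⊗ x′) ⊗ y ⊜ x′ ⊗ (x ⊗ y)) refl x x⁻¹ y ⟩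
      x⁻¹ * (x * y)   ≈⟨ *-congˡ xy≈0 ⟩
      x⁻¹ * 0#        ≈⟨ zeroʳ x⁻¹ ⟩
      0#              ∎

    -- For b ≠ 0 the equation would give τ = -a b⁻¹ ∈ K₀.
    1,τ-independent : ∀ {a b} → a ∈ K₀ → b ∈ K₀ → a + τ * b ≈ 0# → b ≈ 0#
    1,τ-independent {a} {b} a∈K₀ b∈K₀ eq = ≈0-stable [K:ℚ]≡4 λ b≉0 →
      case inverse b b≉0 of λ (b⁻¹ , bb⁻¹≈1) → τ∉K₀ (K₀.respects (begin
        - a * b⁻¹                   ≈⟨ *-congʳ (+-identityʳ (- a)) ⟨
        (- a + 0#) * b⁻¹            ≈⟨ *-congʳ (+-congˡ eq) ⟨
        (- a + (a + τ * b)) * b⁻¹   ≈⟨ *-congʳ (+-assoc (- a) a (τ * b)) ⟨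
        (- a + a + τ * b) * b⁻¹     ≈⟨ *-congʳ (trans (+-congʳ (-‿inverseˡ a)) (+-identityˡ _)) ⟩
        τ * b * b⁻¹                 ≈⟨ *-assoc τ b b⁻¹ ⟩
        τ * (b * b⁻¹)               ≈⟨ *-congˡ bb⁻¹≈1 ⟩
        τ * 1#                      ≈⟨ *-identityʳ τ ⟩
        τ                           ∎)
        (K₀.*-closed (K₀.-‿closed a∈K₀) (K₀.inverse-closed b∈K₀ bb⁻¹≈1)))

    -- Multiplication by π clears the denominators of e₁ and e₂ and leaves αa + τβb = 0, to which
    -- the independence of 1 and τ over K₀ applies.
    point≈0⇒≈0 : ∀ {a b} → a ∈ K₀ → b ∈ K₀ → point a b ≈ 0# → a ≈ 0# × b ≈ 0#
    point≈0⇒≈0 {a} {b} a∈K₀ b∈K₀ eq = unit-cancel α.γγ⁻¹≈1 αa≈0 , unit-cancel β.γγ⁻¹≈1 βb≈0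
      where
      cleared : α * a + τ * (β * b) ≈ 0#
      cleared = begin
        α * a + τ * (β * b)          ≈⟨ +-cong (clear-e₁ a) (clear-e₂ b) ⟨
        point (π * a) (π * b)        ≈⟨ point-* π a b ⟨
        π * point a b                ≈⟨ *-congˡ eq ⟩
        π * 0#                       ≈⟨ zeroʳ π ⟩
        0#                           ∎
      βb≈0 : β * b ≈ 0#
      βb≈0 = 1,τ-independent (K₀.*-closed α.γ∈K₀ a∈K₀) (K₀.*-closed β.γ∈K₀ b∈K₀) cleared
      αa≈0 : α * a ≈ 0#
      αa≈0 = begin
        α * a                  ≈⟨ +-identityʳ _ ⟨
        α * a + 0#             ≈⟨ +-congˡ (trans (*-congˡ βb≈0) (zeroʳ τ)) ⟨
        α * a + τ * (β * b)    ≈⟨ cleared ⟩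
        0#                     ∎

    point-injective : ∀ {a b c d} → a ∈ K₀ → b ∈ K₀ → c ∈ K₀ → d ∈ K₀ →
      point a b ≈ point c d → a ≈ c × b ≈ d
    point-injective {a} {b} {c} {d} a∈ b∈ c∈ d∈ eq =
      x∙y⁻¹≈ε⇒x≈y a c (proj₁ difference) , x∙y⁻¹≈ε⇒x≈y b d (proj₂ difference)
      where
      difference : a - c ≈ 0# × b - d ≈ 0#
      difference = point≈0⇒≈0 (K₀.+-closed a∈ (K₀.-‿closed c∈)) (K₀.+-closed b∈ (K₀.-‿closed d∈)) (begin
        point (a - c) (b - d)              ≈⟨ point-+ a b (- c) (- d) ⟨
        point a b + point (- c) (- d)      ≈⟨ +-congʳ eq ⟩
        point c d + point (- c) (- d)      ≈⟨ point-+ c d (- c) (- d) ⟩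
        point (c - c) (d - d)              ≈⟨ point-cong (-‿inverseʳ c) (-‿inverseʳ d) ⟩
        point 0# 0#                        ≈⟨ point-0# ⟩
        0#                                 ∎)

    Coordinates : Set₁
    Coordinates = Carrier → Carrier → Set

    Span : Coordinates → Subset
    Span P x = ∃[ a ] ∃[ b ] (P a b × x ≈ point a b)

    record IsCoordinateModule (P : Coordinates) : Set where
      field
        0#-closed : P 0# 0#
        +-closed  : ∀ {a b c d} → P a b → P c d → P (a + c) (b + d)
        *-closed  : ∀ {r a b} → r ∈ 𝒪₀ → P a b → P (r * a) (r * b)

    Span-submodule : ∀ {P} → IsCoordinateModule P → IsSubmodule (Span P)
    Span-submodule linear = record
      { respects  = λ x≈y (a , b , p , eq) → a , b , p , trans (sym x≈y) eq
      ; 0#-closed = 0# , 0# , P.0#-closed , sym point-0#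
      ; +-closed  = λ (a , b , p , eq) (c , d , q , eq′) →
          a + c , b + d , P.+-closed p q , trans (+-cong eq eq′) (point-+ a b c d)
      ; *-closed  = λ {r} r∈𝒪₀ (a , b , p , eq) →
          r * a , r * b , P.*-closed r∈𝒪₀ p , trans (*-congˡ eq) (point-* r a b)
      }
      where module P = IsCoordinateModule linear

    submodule-transport : ∀ {I J} → I ≐ J → IsSubmodule J → IsSubmodule I
    submodule-transport (I⊆J , J⊆I) J-submodule = record
      { respects  = λ x≈y x∈I → J⊆I (J.respects x≈y (I⊆J x∈I))
      ; 0#-closed = J⊆I J.0#-closed
      ; +-closed  = λ x∈I y∈I → J⊆I (J.+-closed (I⊆J x∈I) (I⊆J y∈I))
      ; *-closed  = λ r∈𝒪₀ x∈I → J⊆I (J.*-closed r∈𝒪₀ (I⊆J x∈I))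
      }
      where module J = IsSubmodule J-submodule

    •-submodule : ∀ {J} c → IsSubmodule J → IsSubmodule (c • J)
    •-submodule c J-submodule = record
      { respects  = λ x≈y (a , a∈J , eq) → a , a∈J , trans (sym x≈y) eq
      ; 0#-closed = 0# , J.0#-closed , sym (zeroʳ c)
      ; +-closed  = λ (a , a∈J , eq) (b , b∈J , eq′) →
          a + b , J.+-closed a∈J b∈J , trans (+-cong eq eq′) (sym (distribˡ c a b))
      ; *-closed  = λ {r} r∈𝒪₀ (a , a∈J , eq) → r * a , J.*-closed r∈𝒪₀ a∈J
          , trans (*-congˡ eq) (*-solve 3 (λ r c a → r ⊗ (c ⊗ a) ⊜ c ⊗ (r ⊗ a)) refl r c a)
      }
      where module J = IsSubmodule J-submodule

    ⁻¹-submodule : ∀ {I} → IsSubmodule (I ⁻¹)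
    ⁻¹-submodule = record
      { respects  = λ x≈y (x∈K₀ , f) → K₀.respects x≈y x∈K₀ , λ z∈I → respects (*-congʳ x≈y) (f z∈I)
      ; 0#-closed = K₀.0#-closed , λ _ → respects (sym (zeroˡ _)) 0#-closed
      ; +-closed  = λ (x∈K₀ , f) (y∈K₀ , g) → K₀.+-closed x∈K₀ y∈K₀
          , λ z∈I → respects (sym (distribʳ _ _ _)) (+-closed (f z∈I) (g z∈I))
      ; *-closed  = λ r∈𝒪₀ (x∈K₀ , f) → K₀.*-closed (proj₁ r∈𝒪₀) x∈K₀
          , λ z∈I → respects (sym (*-assoc _ _ _)) (*-closed r∈𝒪₀ (f z∈I))
      }

    ⁻¹-principal : ∀ {I} (g : Generator I) → I ⁻¹ ≐ Generator.γ⁻¹ g • 𝒪₀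
    ⁻¹-principal {I} g =
        (λ {x} (_ , f) → x * γ , f (proj₂ generates (1# , 1#-closed , sym (*-identityʳ γ))) , (begin
          x              ≈⟨ *-identityʳ x ⟨
          x * 1#         ≈⟨ *-congˡ γγ⁻¹≈1 ⟨
          x * (γ * γ⁻¹)  ≈⟨ *-solve 3 (λ x c d → x ⊗ (c ⊗ d) ⊜ d ⊗ (x ⊗ c)) refl x γ γ⁻¹ ⟩
          γ⁻¹ * (x * γ)  ∎))
      , λ {x} (a , a∈𝒪₀ , eq) → K₀.respects (sym eq) (K₀.*-closed γ⁻¹∈K₀ (proj₁ a∈𝒪₀))
      , λ {y} y∈I → case proj₁ generates y∈I of λ (b , b∈𝒪₀ , eq′) → respects (begin
          a * b                ≈⟨ *-identityˡ _ ⟨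
          1# * (a * b)         ≈⟨ *-congʳ γγ⁻¹≈1 ⟨
          γ * γ⁻¹ * (a * b)    ≈⟨ *-solve 4 (λ c d a b → (c ⊗ d) ⊗ (a ⊗ b) ⊜ (d ⊗ a) ⊗ (c ⊗ b)) refl γ γ⁻¹ a b ⟩
          (γ⁻¹ * a) * (γ * b)  ≈⟨ *-cong eq eq′ ⟨
          x * y                ∎) (*-closed a∈𝒪₀ b∈𝒪₀)
      where open Generator g

    Both : Subset → Coordinates
    Both I a b = a ∈ I × b ∈ I

    Both-linear : ∀ {I} → IsSubmodule I → IsCoordinateModule (Both I)
    Both-linear I-submodule = record
      { 0#-closed = I.0#-closed , I.0#-closed
      ; +-closed  = λ (p , q) (p′ , q′) → I.+-closed p p′ , I.+-closed q q′
      ; *-closed  = λ r∈𝒪₀ (p , q) → I.*-closed r∈𝒪₀ p , I.*-closed r∈𝒪₀ q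
      }
      where module I = IsSubmodule I-submodule

    Λ≐ : Λ ≐ Span (Both 𝔩)
    Λ≐ = to , from
      where
      to : Λ ⊆ Span (Both 𝔩)
      to (a , b , a∈Λ₁ , (c , c∈Λ₂ , b≈) , x≈)
        with r , r∈𝒪₀ , a≈ ← proj₁ α.generates a∈Λ₁ | s , s∈𝒪₀ , c≈ ← proj₁ β.generates c∈Λ₂ =
        π * r , π * s , (proj₂ π.generates (r , r∈𝒪₀ , refl) , proj₂ π.generates (s , s∈𝒪₀ , refl))
        , trans x≈ (+-cong (trans a≈ (sym (clear-e₁ r)))
            (trans b≈ (trans (*-congˡ c≈) (sym (clear-e₂ s)))))
      from : Span (Both 𝔩) ⊆ Λ
      from (a , b , (a∈𝔩 , b∈𝔩) , x≈)
        with r , r∈𝒪₀ , a≈ ← proj₁ π.generates a∈𝔩 | s , s∈𝒪₀ , b≈ ← proj₁ π.generates b∈𝔩 =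
        α * r , τ * (β * s) , proj₂ α.generates (r , r∈𝒪₀ , refl)
        , (β * s , proj₂ β.generates (s , s∈𝒪₀ , refl) , refl)
        , trans x≈ (+-cong (trans (*-congʳ a≈) (clear-e₁ r)) (trans (*-congʳ b≈) (clear-e₂ s)))

    Λ-submodule : IsSubmodule Λ
    Λ-submodule = submodule-transport Λ≐ (Span-submodule (Both-linear (ideal⇒submodule (IsPrimeIdeal.isFractionalIdeal 𝔩-prime))))

    𝔩⁻¹· : ∀ {J} → IsSubmodule J → 𝔩 ⁻¹ · J ≐ π⁻¹ • J
    𝔩⁻¹· = principal-· (⁻¹-principal 𝔩-generator) 1#-closed

    M≐ : 𝔩 ⁻¹ · Λ ≐ Span (Both 𝒪₀)
    M≐ = to , from
      where
      divided : ∀ r s → point r s ≈ π⁻¹ * (α * r + τ * (β * s))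
      divided r s = trans (+-cong
        (*-solve 3 (λ q a r → r ⊗ (q ⊗ a) ⊜ q ⊗ (a ⊗ r)) refl π⁻¹ α r)
        (*-solve 4 (λ q t b s → s ⊗ (q ⊗ (t ⊗ b)) ⊜ q ⊗ (t ⊗ (b ⊗ s))) refl π⁻¹ τ β s))
        (sym (distribˡ π⁻¹ (α * r) (τ * (β * s))))
      to : 𝔩 ⁻¹ · Λ ⊆ Span (Both 𝒪₀)
      to x∈
        with y , (a , b , a∈Λ₁ , (c , c∈Λ₂ , b≈) , y≈) , x≈ ← proj₁ (𝔩⁻¹· Λ-submodule) x∈
        with r , r∈𝒪₀ , a≈ ← proj₁ α.generates a∈Λ₁ | s , s∈𝒪₀ , c≈ ← proj₁ β.generates c∈Λ₂ =
        r , s , (r∈𝒪₀ , s∈𝒪₀) , trans x≈ (trans (*-congˡ (trans y≈ (+-cong a≈ (trans b≈ (*-congˡ c≈)))))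
          (sym (divided r s)))
      from : Span (Both 𝒪₀) ⊆ 𝔩 ⁻¹ · Λ
      from (r , s , (r∈𝒪₀ , s∈𝒪₀) , x≈) = proj₂ (𝔩⁻¹· Λ-submodule) (α * r + τ * (β * s)
        , (α * r , τ * (β * s) , proj₂ α.generates (r , r∈𝒪₀ , refl)
          , (β * s , proj₂ β.generates (s , s∈𝒪₀ , refl) , refl) , refl)
        , trans x≈ (divided r s))

    -- The inverse of r ↦ αβ⁻¹r. It identifies Λ₁Λ₂⁻¹ with 𝒪₀ and 𝔩Λ₁Λ₂⁻¹ with 𝔩, so the finite
    -- indices become residues modulo 𝔩.
    slope : Carrier → Carrier
    slope ρ = α⁻¹ * β * ρ

    slope-α : ∀ ρ → α * slope ρ ≈ β * ρ
    slope-α ρ = trans (*-solve 4 (λ a a′ b r → a ⊗ ((a′ ⊗ b) ⊗ r) ⊜ (a ⊗ a′) ⊗ (b ⊗ r)) refl α α⁻¹ β ρ)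
      (sym (insert (β * ρ) α.γγ⁻¹≈1))

    slope∈𝒪₀ : ∀ {ρ} → ρ ∈ Λ₁ · Λ₂ ⁻¹ → slope ρ ∈ 𝒪₀
    slope∈𝒪₀ {ρ} ρ∈
      with y , y∈ , ρ≈ ← proj₁ (principal-· α.generates 1#-closed ⁻¹-submodule) ρ∈
      with t , t∈𝒪₀ , y≈ ← proj₁ (⁻¹-principal Λ₂-generator) y∈ = respects (sym (begin
        α⁻¹ * β * ρ                 ≈⟨ *-congˡ (trans ρ≈ (*-congˡ y≈)) ⟩
        α⁻¹ * β * (α * (β⁻¹ * t))
          ≈⟨ *-solve 5 (λ a a′ b b′ t → (a′ ⊗ b) ⊗ (a ⊗ (b′ ⊗ t)) ⊜ (a ⊗ a′) ⊗ ((b ⊗ b′) ⊗ t)) refl α α⁻¹ β β⁻¹ t ⟩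
        α * α⁻¹ * (β * β⁻¹ * t)     ≈⟨ insert (β * β⁻¹ * t) α.γγ⁻¹≈1 ⟨
        β * β⁻¹ * t                 ≈⟨ insert t β.γγ⁻¹≈1 ⟨
        t                           ∎)) t∈𝒪₀

    -- 𝔩⁻¹Λ/Λ is a plane over 𝒪₀/𝔩 with basis e₁, e₂, and overlattice i is the
    -- preimage of one of its lines.
    Line : Index → Coordinates
    Line nothing        a b = a ∈ 𝒪₀ × b ∈ 𝔩
    Line (just (ρ , _)) a b = b ∈ 𝒪₀ × a ≡ slope ρ * b [mod 𝔩 ]

    Line-linear : ∀ i → IsCoordinateModule (Line i)
    Line-linear nothing = record
      { 0#-closed = 0#-closed , 𝔩.0#-closed
      ; +-closed  = λ (p , q) (p′ , q′) → +-closed p p′ , 𝔩.+-closed q q′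
      ; *-closed  = λ r∈𝒪₀ (p , q) → *-closed r∈𝒪₀ p , 𝔩.*-closed r∈𝒪₀ q
      }
    Line-linear (just (ρ , _)) = record
      { 0#-closed = 0#-closed , mod-reflexive (sym (zeroʳ _))
      ; +-closed  = λ (p , q) (p′ , q′) → +-closed p p′
          , mod-trans (mod-+ q q′) (mod-reflexive (sym (distribˡ _ _ _)))
      ; *-closed  = λ {r} {_} {b} r∈𝒪₀ (p , q) → *-closed r∈𝒪₀ p
          , mod-trans (mod-* r∈𝒪₀ q) (mod-reflexive
              (*-solve 3 (λ r s b → r ⊗ (s ⊗ b) ⊜ s ⊗ (r ⊗ b)) refl r (slope ρ) b))
      }

    overlattice≐ : ∀ i → overlattice i ≐ Span (Line i)
    overlattice≐ nothing = to , from
      where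
      e₁-form : ∀ r → r * e₁ ≈ π⁻¹ * (α * r)
      e₁-form r = *-solve 3 (λ q a r → r ⊗ (q ⊗ a) ⊜ q ⊗ (a ⊗ r)) refl π⁻¹ α r
      to : overlattice nothing ⊆ Span (Line nothing)
      to (a , b , a∈ , (c , c∈Λ₂ , b≈) , x≈)
        with y , y∈Λ₁ , a≈ ← proj₁ (𝔩⁻¹· (ideal⇒submodule Λ₁-ideal)) a∈
        with r , r∈𝒪₀ , y≈ ← proj₁ α.generates y∈Λ₁ | s , s∈𝒪₀ , c≈ ← proj₁ β.generates c∈Λ₂ =
        r , π * s , (r∈𝒪₀ , proj₂ π.generates (s , s∈𝒪₀ , refl))
        , trans x≈ (+-cong (trans a≈ (trans (*-congˡ y≈) (sym (e₁-form r))))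
            (trans b≈ (trans (*-congˡ c≈) (sym (clear-e₂ s)))))
      from : Span (Line nothing) ⊆ overlattice nothing
      from (r , b , (r∈𝒪₀ , b∈𝔩) , x≈) with s , s∈𝒪₀ , b≈ ← proj₁ π.generates b∈𝔩 =
        π⁻¹ * (α * r) , τ * (β * s)
        , proj₂ (𝔩⁻¹· (ideal⇒submodule Λ₁-ideal)) (α * r , proj₂ α.generates (r , r∈𝒪₀ , refl) , refl)
        , (β * s , proj₂ β.generates (s , s∈𝒪₀ , refl) , refl)
        , trans x≈ (+-cong (e₁-form r) (trans (*-congʳ b≈) (clear-e₂ s)))
    overlattice≐ (just (ρ , ρ∈)) = to , from
      where
      -- As βρ = α · slope ρ, the ρ-part of (τ + ρ)π⁻¹βs is the multiple (slope ρ) s of e₁, and its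
      -- τ-part is s e₂.
      expanded : ∀ r s → point (slope ρ * s + π * r) s ≈ α * r + (τ + ρ) * (π⁻¹ * (β * s))
      expanded r s = begin
        (slope ρ * s + π * r) * e₁ + s * e₂
          ≈⟨ +-cong (distribʳ e₁ (slope ρ * s) (π * r)) s*e₂ ⟩
        slope ρ * s * e₁ + π * r * e₁ + τ * f
          ≈⟨ +-congʳ (+-cong slope*e₁ (clear-e₁ r)) ⟩
        ρ * f + α * r + τ * f
          ≈⟨ solve 3 (λ x y z → x :+ y :+ z := y :+ (z :+ x)) refl (ρ * f) (α * r) (τ * f) ⟩
        α * r + (τ * f + ρ * f)
          ≈⟨ +-congˡ (distribʳ f τ ρ) ⟨
        α * r + (τ + ρ) * f ∎
        where
        f : Carrier
        f = π⁻¹ * (β * s)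
        s*e₂ : s * e₂ ≈ τ * f
        s*e₂ = *-solve 4 (λ q t b s → s ⊗ (q ⊗ (t ⊗ b)) ⊜ t ⊗ (q ⊗ (b ⊗ s))) refl π⁻¹ τ β s
        slope*e₁ : slope ρ * s * e₁ ≈ ρ * f
        slope*e₁ = begin
          slope ρ * s * (π⁻¹ * α)
            ≈⟨ *-solve 4 (λ l s q a → (l ⊗ s) ⊗ (q ⊗ a) ⊜ (a ⊗ l) ⊗ (q ⊗ s)) refl (slope ρ) s π⁻¹ α ⟩
          α * slope ρ * (π⁻¹ * s)  ≈⟨ *-congʳ (slope-α ρ) ⟩
          β * ρ * (π⁻¹ * s)
            ≈⟨ *-solve 4 (λ b r q s → (b ⊗ r) ⊗ (q ⊗ s) ⊜ r ⊗ (q ⊗ (b ⊗ s))) refl β ρ π⁻¹ s ⟩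
          ρ * f                    ∎
      to : overlattice (just (ρ , ρ∈)) ⊆ Span (Line (just (ρ , ρ∈)))
      to (a , b , a∈Λ₁ , (c , c∈ , b≈) , x≈)
        with y , y∈Λ₂ , c≈ ← proj₁ (𝔩⁻¹· (ideal⇒submodule Λ₂-ideal)) c∈
        with r , r∈𝒪₀ , a≈ ← proj₁ α.generates a∈Λ₁ | s , s∈𝒪₀ , y≈ ← proj₁ β.generates y∈Λ₂ =
        slope ρ * s + π * r , s , (s∈𝒪₀ , π * r , proj₂ π.generates (r , r∈𝒪₀ , refl) , refl)
        , trans x≈ (trans (+-cong a≈ (trans b≈ (*-congˡ (trans c≈ (*-congˡ y≈))))) (sym (expanded r s)))
      from : Span (Line (just (ρ , ρ∈))) ⊆ overlattice (just (ρ , ρ∈))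
      from (a , s , (s∈𝒪₀ , p , p∈𝔩 , a≈) , x≈) with r , r∈𝒪₀ , p≈ ← proj₁ π.generates p∈𝔩 =
        α * r , (τ + ρ) * (π⁻¹ * (β * s)) , proj₂ α.generates (r , r∈𝒪₀ , refl)
        , (π⁻¹ * (β * s)
          , proj₂ (𝔩⁻¹· (ideal⇒submodule Λ₂-ideal)) (β * s , proj₂ β.generates (s , s∈𝒪₀ , refl) , refl)
          , refl)
        , trans x≈ (trans (point-cong (trans a≈ (+-congˡ p≈)) refl) (expanded r s))

    overlattice-submodule : ∀ i → IsSubmodule (overlattice i)
    overlattice-submodule i = submodule-transport (overlattice≐ i) (Span-submodule (Line-linear i))

    private
      module Λ     = IsSubmodule Λ-submodule
      module Λ-mod = Λ.Congruence -1∈𝒪₀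

    point-mod : ∀ {a b c d} → a ≡ c [mod 𝔩 ] → b ≡ d [mod 𝔩 ] → point a b ≡ point c d [mod Λ ]
    point-mod {c = c} {d} (p , p∈𝔩 , a≈) (q , q∈𝔩 , b≈) =
      point p q , proj₂ Λ≐ (p , q , (p∈𝔩 , q∈𝔩) , refl)
      , trans (point-cong a≈ b≈) (sym (point-+ c d p q))

    mod-point : ∀ {a b c d} → a ∈ 𝒪₀ → b ∈ 𝒪₀ → c ∈ 𝒪₀ → d ∈ 𝒪₀ →
      point a b ≡ point c d [mod Λ ] → a ≡ c [mod 𝔩 ] × b ≡ d [mod 𝔩 ]
    mod-point {c = c} {d} a∈ b∈ c∈ d∈ (x , x∈Λ , eq) =
      case proj₁ Λ≐ x∈Λ of λ (p , q , (p∈𝔩 , q∈𝔩) , x≈) →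
      case point-injective (proj₁ a∈) (proj₁ b∈)
             (K₀.+-closed (proj₁ c∈) (proj₁ (𝔩⊆𝒪₀ p∈𝔩))) (K₀.+-closed (proj₁ d∈) (proj₁ (𝔩⊆𝒪₀ q∈𝔩)))
             (trans eq (trans (+-congˡ x≈) (point-+ c d p q)))
      of λ (a≈ , b≈) → (p , p∈𝔩 , a≈) , (q , q∈𝔩 , b≈)
      where
      𝔩⊆𝒪₀ : 𝔩 ⊆ 𝒪₀
      𝔩⊆𝒪₀ = IsPrimeIdeal.integral 𝔩-prime

    Line⊆Both : ∀ i {a b} → Line i a b → Both 𝒪₀ a b
    Line⊆Both nothing         (a∈𝒪₀ , b∈𝔩) = a∈𝒪₀ , IsPrimeIdeal.integral 𝔩-prime b∈𝔩
    Line⊆Both (just (ρ , ρ∈)) (b∈𝒪₀ , p , p∈𝔩 , a≈) =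
      respects (sym a≈) (+-closed (*-closed (slope∈𝒪₀ ρ∈) b∈𝒪₀) (IsPrimeIdeal.integral 𝔩-prime p∈𝔩)) , b∈𝒪₀

    Line-respects : ∀ i {a b c d} → a ≈ c → b ≈ d → Line i a b → Line i c d
    Line-respects nothing        a≈c b≈d (p , q) = respects a≈c p , 𝔩.respects b≈d q
    Line-respects (just (ρ , _)) a≈c b≈d (p , q) = respects b≈d p
      , mod-trans (mod-reflexive (sym a≈c)) (mod-trans q (mod-reflexive (*-congˡ b≈d)))

    ∈⇒Line : ∀ i {a b} → a ∈ 𝒪₀ → b ∈ 𝒪₀ → point a b ∈ overlattice i → Line i a b
    ∈⇒Line i a∈ b∈ p =
      case proj₁ (overlattice≐ i) p of λ (c , d , line , eq) →
      case point-injective (proj₁ a∈) (proj₁ b∈)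
             (proj₁ (proj₁ (Line⊆Both i line))) (proj₁ (proj₂ (Line⊆Both i line))) eq of λ (a≈c , b≈d) →
      Line-respects i (sym a≈c) (sym b≈d) line

    Λ⊆overlattice : ∀ i → Λ ⊆ overlattice i
    Λ⊆overlattice i x∈Λ with a , b , (a∈𝔩 , b∈𝔩) , x≈ ← proj₁ Λ≐ x∈Λ =
      proj₂ (overlattice≐ i) (a , b , line i , x≈)
      where
      line : ∀ i → Line i a b
      line nothing         = IsPrimeIdeal.integral 𝔩-prime a∈𝔩 , b∈𝔩
      line (just (ρ , ρ∈)) = IsPrimeIdeal.integral 𝔩-prime b∈𝔩
        , mod-trans (∈⇒mod-0 a∈𝔩) (mod-sym (∈⇒mod-0 (𝔩.*-closed (slope∈𝒪₀ ρ∈) b∈𝔩)))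

    overlattice⊆M : ∀ i → overlattice i ⊆ 𝔩 ⁻¹ · Λ
    overlattice⊆M i x∈ with a , b , line , x≈ ← proj₁ (overlattice≐ i) x∈ =
      proj₂ M≐ (a , b , Line⊆Both i line , x≈)

    gen₁ gen₂ : Index → Carrier
    gen₁ nothing        = 1#
    gen₁ (just (ρ , _)) = slope ρ
    gen₂ nothing        = 0#
    gen₂ (just _)       = 1#

    gen₁∈𝒪₀ : ∀ i → gen₁ i ∈ 𝒪₀
    gen₁∈𝒪₀ nothing         = 1#-closed
    gen₁∈𝒪₀ (just (ρ , ρ∈)) = slope∈𝒪₀ ρ∈

    gen₂∈𝒪₀ : ∀ i → gen₂ i ∈ 𝒪₀
    gen₂∈𝒪₀ nothing  = 0#-closed
    gen₂∈𝒪₀ (just _) = 1#-closed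

    generator : Index → Carrier
    generator i = point (gen₁ i) (gen₂ i)

    generator∈ : ∀ i → generator i ∈ overlattice i
    generator∈ i = proj₂ (overlattice≐ i) (gen₁ i , gen₂ i , line i , refl)
      where
      line : ∀ i → Line i (gen₁ i) (gen₂ i)
      line nothing        = 1#-closed , 𝔩.0#-closed
      line (just (ρ , _)) = 1#-closed , mod-reflexive (sym (*-identityʳ (slope ρ)))

    1∉𝔩 : 1# ∉ 𝔩
    1∉𝔩 = IsPrimeIdeal.proper 𝔩-prime

    -- One coordinate of the generator is 1. Matching that coordinate of x modulo 𝔩 determines j,
    -- and the equation of the line settles the other; the same coordinate tells the multiples apart
    -- in `generator-order`.
    overlattice-cyclic : ∀ i {x} → x ∈ overlattice i →
      ∃[ j ] x ≡ toℕ {ℓ} j times generator i [mod Λ ]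
    overlattice-cyclic i x∈ with a , b , line , x≈ ← proj₁ (overlattice≐ i) x∈ =
      case multiple i line of λ (j , a≡ , b≡) → j ,
        Λ-mod.mod-trans (Λ-mod.mod-reflexive x≈) (Λ-mod.mod-trans (point-mod a≡ b≡)
          (Λ-mod.mod-reflexive (sym (point-times (toℕ j) (gen₁ i) (gen₂ i)))))
      where
      multiple : ∀ i → Line i a b → ∃[ j ]
        (a ≡ toℕ {ℓ} j times gen₁ i [mod 𝔩 ] × b ≡ toℕ {ℓ} j times gen₂ i [mod 𝔩 ])
      multiple nothing (a∈𝒪₀ , b∈𝔩) with j , a≡ ← times-surjective 1#-closed 1∉𝔩 a∈𝒪₀ =
        j , a≡ , mod-trans (∈⇒mod-0 b∈𝔩) (mod-sym (∈⇒mod-0 (𝔩.times-closed (toℕ j) 𝔩.0#-closed)))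
      multiple (just (ρ , ρ∈)) (b∈𝒪₀ , a≡) with j , b≡ ← times-surjective 1#-closed 1∉𝔩 b∈𝒪₀ =
        j , mod-trans a≡ (mod-trans (mod-* (slope∈𝒪₀ ρ∈) b≡) (mod-reflexive
          (trans (×-comm-* (toℕ j) (slope ρ) 1#) (×-congʳ (toℕ j) (*-identityʳ (slope ρ)))))) , b≡

    generator-order : ∀ i {j k : Fin ℓ} →
      toℕ j times generator i ≡ toℕ k times generator i [mod Λ ] → j ≡ k
    generator-order i {j} {k} eq = unit i (mod-point
        (times∈𝒪₀ (toℕ j) (gen₁∈𝒪₀ i)) (times∈𝒪₀ (toℕ j) (gen₂∈𝒪₀ i))
        (times∈𝒪₀ (toℕ k) (gen₁∈𝒪₀ i)) (times∈𝒪₀ (toℕ k) (gen₂∈𝒪₀ i))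
        (Λ-mod.mod-trans (Λ-mod.mod-reflexive (sym (point-times (toℕ j) (gen₁ i) (gen₂ i))))
          (Λ-mod.mod-trans eq (Λ-mod.mod-reflexive (point-times (toℕ k) (gen₁ i) (gen₂ i))))))
      where
      unit : ∀ i → toℕ j times gen₁ i ≡ toℕ k times gen₁ i [mod 𝔩 ] ×
                   toℕ j times gen₂ i ≡ toℕ k times gen₂ i [mod 𝔩 ] → j ≡ k
      unit nothing  (p , _) = times-injective 1#-closed 1∉𝔩 p
      unit (just _) (_ , p) = times-injective 1#-closed 1∉𝔩 p

    generator∉Λ : ∀ i → generator i ∉ Λ
    generator∉Λ i p = unit i (mod-point (gen₁∈𝒪₀ i) (gen₂∈𝒪₀ i) 0#-closed 0#-closed
        (Λ-mod.mod-trans (Λ-mod.∈⇒mod-0 p) (Λ-mod.mod-reflexive (sym point-0#))))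
      where
      unit : ∀ i → ¬ (gen₁ i ≡ 0# [mod 𝔩 ] × gen₂ i ≡ 0# [mod 𝔩 ])
      unit nothing  (p , _) = 1∉𝔩 (mod-closed p 𝔩.0#-closed)
      unit (just _) (_ , p) = 1∉𝔩 (mod-closed p 𝔩.0#-closed)

    private
      α•β⁻¹• : Λ₁ · Λ₂ ⁻¹ ≐ α • Λ₂ ⁻¹
      α•β⁻¹• = principal-· α.generates 1#-closed ⁻¹-submodule

      lift : ∀ r → r ∈ 𝒪₀ → α * (β⁻¹ * r) ∈ Λ₁ · Λ₂ ⁻¹
      lift r r∈𝒪₀ = proj₂ α•β⁻¹•
        (β⁻¹ * r , proj₂ (⁻¹-principal Λ₂-generator) (r , r∈𝒪₀ , refl) , refl)

      slope-lift : ∀ r → slope (α * (β⁻¹ * r)) ≈ r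
      slope-lift r = begin
        α⁻¹ * β * (α * (β⁻¹ * r))
          ≈⟨ *-solve 5 (λ a a′ b b′ t → (a′ ⊗ b) ⊗ (a ⊗ (b′ ⊗ t)) ⊜ (a ⊗ a′) ⊗ ((b ⊗ b′) ⊗ t)) refl α α⁻¹ β β⁻¹ r ⟩
        α * α⁻¹ * (β * β⁻¹ * r)     ≈⟨ insert (β * β⁻¹ * r) α.γγ⁻¹≈1 ⟨
        β * β⁻¹ * r                 ≈⟨ insert r β.γγ⁻¹≈1 ⟨
        r                           ∎

      lift-slope : ∀ ρ → α * (β⁻¹ * slope ρ) ≈ ρ
      lift-slope ρ = begin
        α * (β⁻¹ * (α⁻¹ * β * ρ))
          ≈⟨ *-solve 5 (λ a a′ b b′ t → a ⊗ (b′ ⊗ ((a′ ⊗ b) ⊗ t)) ⊜ (a ⊗ a′) ⊗ ((b ⊗ b′) ⊗ t)) refl α α⁻¹ β β⁻¹ ρ ⟩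
        α * α⁻¹ * (β * β⁻¹ * ρ)     ≈⟨ insert (β * β⁻¹ * ρ) α.γγ⁻¹≈1 ⟨
        β * β⁻¹ * ρ                 ≈⟨ insert ρ β.γγ⁻¹≈1 ⟨
        ρ                           ∎

      Λ₁Λ₂⁻¹-submodule : IsSubmodule (Λ₁ · Λ₂ ⁻¹)
      Λ₁Λ₂⁻¹-submodule = submodule-transport α•β⁻¹• (•-submodule α ⁻¹-submodule)

      𝔩Λ₁Λ₂⁻¹≐ : 𝔩 · (Λ₁ · Λ₂ ⁻¹) ≐ π • (Λ₁ · Λ₂ ⁻¹)
      𝔩Λ₁Λ₂⁻¹≐ = principal-· π.generates 1#-closed Λ₁Λ₂⁻¹-submodule

    slope-cong : ∀ {ρ σ} → ρ - σ ∈ 𝔩 · (Λ₁ · Λ₂ ⁻¹) → slope ρ ≡ slope σ [mod 𝔩 ]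
    slope-cong {ρ} {σ} p
      with d , d∈ , ρ≈ ← -⇒mod p
      with t , t∈ , d≈ ← proj₁ 𝔩Λ₁Λ₂⁻¹≐ d∈ =
      slope d , proj₂ π.generates (slope t , slope∈𝒪₀ t∈ , (begin
        α⁻¹ * β * d         ≈⟨ *-congˡ d≈ ⟩
        α⁻¹ * β * (π * t)   ≈⟨ *-solve 3 (λ c p t → c ⊗ (p ⊗ t) ⊜ p ⊗ (c ⊗ t)) refl (α⁻¹ * β) π t ⟩
        π * (α⁻¹ * β * t)   ∎)) , trans (*-congˡ ρ≈) (distribˡ (α⁻¹ * β) σ d)

    slope-reflects : ∀ {ρ σ} → slope ρ ≡ slope σ [mod 𝔩 ] → ρ - σ ∈ 𝔩 · (Λ₁ · Λ₂ ⁻¹)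
    slope-reflects {ρ} {σ} (p , p∈𝔩 , eq) with r , r∈𝒪₀ , p≈ ← proj₁ π.generates p∈𝔩 =
      mod⇒- (λ x≈y x∈ → proj₂ 𝔩Λ₁Λ₂⁻¹≐ (IsSubmodule.respects (•-submodule π Λ₁Λ₂⁻¹-submodule) x≈y (proj₁ 𝔩Λ₁Λ₂⁻¹≐ x∈)))
        (π * (α * (β⁻¹ * r)) , proj₂ 𝔩Λ₁Λ₂⁻¹≐ (α * (β⁻¹ * r) , lift r r∈𝒪₀ , refl) , (begin
          ρ                                           ≈⟨ lift-slope ρ ⟨
          α * (β⁻¹ * slope ρ)                         ≈⟨ *-assoc α β⁻¹ (slope ρ) ⟨
          α * β⁻¹ * slope ρ                           ≈⟨ *-congˡ (trans eq (+-congˡ p≈)) ⟩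
          α * β⁻¹ * (slope σ + π * r)                 ≈⟨ distribˡ (α * β⁻¹) (slope σ) (π * r) ⟩
          α * β⁻¹ * slope σ + α * β⁻¹ * (π * r)
            ≈⟨ +-cong (trans (*-assoc α β⁻¹ (slope σ)) (lift-slope σ))
                 (*-solve 4 (λ a b p r → (a ⊗ b) ⊗ (p ⊗ r) ⊜ p ⊗ (a ⊗ (b ⊗ r))) refl α β⁻¹ π r) ⟩
          σ + π * (α * (β⁻¹ * r))                     ∎))

    overlattice-cong : ∀ {i j} → i ≈-index j → overlattice i ⊆ overlattice j
    overlattice-cong {i} {j} i≈j x∈ with a , b , line , x≈ ← proj₁ (overlattice≐ i) x∈ =
      proj₂ (overlattice≐ j) (a , b , transfer i≈j line , x≈)
      where
      transfer : ∀ {i j} → i ≈-index j → Line i a b → Line j a b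
      transfer nothing line = line
      transfer {just (ρ , _)} {just (σ , _)} (just ρ≈σ) (b∈𝒪₀ , a≡) = b∈𝒪₀ , mod-trans a≡
        (mod-trans (mod-reflexive (*-comm (slope ρ) b)) (mod-trans (mod-* b∈𝒪₀ (slope-cong ρ≈σ))
          (mod-reflexive (*-comm b (slope σ)))))

    index-sym : ∀ {i j} → i ≈-index j → j ≈-index i
    index-sym nothing  = nothing
    index-sym (just p) = just (slope-reflects (mod-sym (slope-cong p)))

    -- One inclusion is enough, the lattices being preimages of lines: it suffices to put the
    -- generator of i into the equation of line j. Between ∞ and a finite slope this would force 1 ∈
    -- 𝔩.
    overlattice-injective : ∀ {i j} → overlattice i ⊆ overlattice j → i ≈-index j
    overlattice-injective {i} {j} N⊆ =
      compare i j (∈⇒Line j (gen₁∈𝒪₀ i) (gen₂∈𝒪₀ i) (N⊆ (generator∈ i)))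
      where
      compare : ∀ i j → Line j (gen₁ i) (gen₂ i) → i ≈-index j
      compare nothing  nothing  _ = nothing
      compare nothing  (just (σ , _)) (_ , 1≡) =
        ⊥-elim (1∉𝔩 (mod-closed (mod-trans 1≡ (mod-reflexive (zeroʳ (slope σ)))) 𝔩.0#-closed))
      compare (just _) nothing  (_ , 1∈𝔩) = ⊥-elim (1∉𝔩 1∈𝔩)
      compare (just _) (just (σ , _)) (_ , eq) =
        just (slope-reflects (mod-trans eq (mod-reflexive (*-identityʳ (slope σ)))))

    ℓM⊆Λ : ∀ {x} → x ∈ 𝔩 ⁻¹ · Λ → ℓ times x ∈ Λ
    ℓM⊆Λ {x} x∈M = case proj₁ M≐ x∈M of λ (a , b , (a∈𝒪₀ , b∈𝒪₀) , x≈) →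
      Λ.respects {point (ℓ times a) (ℓ times b)} {ℓ times x}
        (trans (sym (point-times ℓ a b)) (×-congʳ ℓ (sym x≈)))
        (proj₂ Λ≐ {point (ℓ times a) (ℓ times b)} (ℓ times a , ℓ times b , (kill a∈𝒪₀ , kill b∈𝒪₀) , refl))
      where
      kill : ∀ {a} → a ∈ 𝒪₀ → ℓ times a ∈ 𝔩
      kill {a} a∈𝒪₀ = 𝔩.respects (trans (×-comm-* ℓ a 1#) (×-congʳ ℓ (*-identityʳ a))) (𝔩.*-closed a∈𝒪₀ ℓ∈𝔩)

    private module Classify {x a b} (a∈𝒪₀ : a ∈ 𝒪₀) (b∈𝒪₀ : b ∈ 𝒪₀) (x≈ : x ≈ point a b) where
      multiple : ∀ {c d} n → c ≡ n times a [mod 𝔩 ] → d ≡ n times b [mod 𝔩 ] →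
        point c d ≡ n times x [mod Λ ]
      multiple n p q = Λ-mod.mod-trans (point-mod p q)
        (Λ-mod.mod-reflexive (trans (sym (point-times n a b)) (×-congʳ n (sym x≈))))

      decide : Dec (b ∈ 𝔩) → Dec (a ∈ 𝔩) → x ∈ Λ ⊎
        (∃[ i ] (x ∈ overlattice i × ∃[ k ] generator i ≡ k times x [mod Λ ]))
      decide (yes b∈𝔩) (yes a∈𝔩) = inj₁ (proj₂ Λ≐ (a , b , (a∈𝔩 , b∈𝔩) , x≈))
      -- Here x lies on the line through e₁; multiplying by an inverse j of a modulo 𝔩 turns x into
      -- e₁.
      decide (yes b∈𝔩) (no  a∉𝔩) with j , 1≡ ← times-surjective a∈𝒪₀ a∉𝔩 1#-closed =
        inj₂ (nothing , proj₂ (overlattice≐ nothing) (a , b , (a∈𝒪₀ , b∈𝔩) , x≈)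
          , toℕ j , multiple (toℕ j) 1≡ (mod-sym (∈⇒mod-0 (𝔩.times-closed (toℕ j) b∈𝔩))))
      -- An inverse j of b modulo 𝔩 normalises the second coordinate to 1, and the first becomes the
      -- slope r = j a.
      decide (no b∉𝔩) _ with j , 1≡ ← times-surjective b∈𝒪₀ b∉𝔩 1#-closed =
        inj₂ (i , proj₂ (overlattice≐ i) (a , b , (b∈𝒪₀ , a≡) , x≈)
          , toℕ j , multiple (toℕ j) (mod-reflexive (slope-lift r)) 1≡)
        where
        r : Carrier
        r = toℕ j times a
        r∈𝒪₀ : r ∈ 𝒪₀
        r∈𝒪₀ = times∈𝒪₀ (toℕ j) a∈𝒪₀
        i : Index
        i = just (α * (β⁻¹ * r) , lift r r∈𝒪₀)
        a≡ : a ≡ slope (α * (β⁻¹ * r)) * b [mod 𝔩 ]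
        -- By the choice of j, a ≡ a (j b) = (j a) b = r b.
        a≡ = mod-trans (mod-reflexive (sym (*-identityʳ a))) (mod-trans (mod-* a∈𝒪₀ 1≡) (mod-reflexive (begin
          a * (toℕ j times b)                ≈⟨ ×-comm-* (toℕ j) a b ⟩
          toℕ j times (a * b)                ≈⟨ ×-assoc-* (toℕ j) a b ⟨
          (toℕ j times a) * b                ≈⟨ *-congʳ (slope-lift r) ⟨
          slope (α * (β⁻¹ * r)) * b          ∎)))

    -- The multiplier `k` is there for the reverse inclusion: x generates the whole line modulo Λ.
    classify : ∀ {x} → x ∈ 𝔩 ⁻¹ · Λ → x ∈ Λ ⊎
      (∃[ i ] (x ∈ overlattice i × ∃[ k ] generator i ≡ k times x [mod Λ ]))
    classify {x} x∈M = case proj₁ M≐ x∈M of λ (a , b , (a∈𝒪₀ , b∈𝒪₀) , x≈) →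
      Classify.decide {x} {a} {b} a∈𝒪₀ b∈𝒪₀ x≈ (b∈𝒪₀ ∈𝔩?) (a∈𝒪₀ ∈𝔩?)

    -- Lattices, kernels and isogenies in ℂ²

    module Tori (type : CMType) (surface : IsAbelianSurface (CMType.Φ[_] type Λ)) where
      open CMType type
      open Images E type
      open Multiplication K using (times-torsionFree)

      private
        instance
          ℓ-nonZero : ℕ.NonZero ℓ
          ℓ-nonZero = prime⇒nonZero ℓ-prime

      L M : Pred ℂ² _
      L = Φ[ Λ ]
      M = Φ[ 𝔩 ⁻¹ · Λ ]

      L′ : Index → Pred ℂ² _
      L′ i = Φ[ overlattice i ]

      L-subgroup : IsSubgroup C².+ᴹ-rawGroup L
      L-subgroup = image-subgroup -1∈𝒪₀ Λ-submodule

      L′-subgroup : ∀ i → IsSubgroup C².+ᴹ-rawGroup (L′ i)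
      L′-subgroup i = image-subgroup -1∈𝒪₀ (overlattice-submodule i)

      private
        module L    = Subgroup L-subgroup
        module L′ i = Subgroup (L′-subgroup i)

      multiple : ℂ² → ℕ → ℂ²
      multiple g n = power (Torus L) g (ℤ.+ n)

      multiples-span : ∀ i {z} → z ∈ L′ i → ∃[ j ] z -² multiple (Φ (generator i)) (toℕ {ℓ} j) ∈ L
      multiples-span i {z} (x , x∈ , eq) = case overlattice-cyclic i x∈ of λ (j , x≡) → j ,
        L.-²-trans {z} {Φ x} (L.≈⇒-² (C².≈ᴹ-sym eq))
          (L.-²-trans {Φ x} {Φ (toℕ j times generator i)} (image-mod x≡)
            (L.≈⇒-² (Φ-power L (toℕ j) (generator i))))

      multiples-distinct : ∀ i {j k : Fin ℓ} → multiple (Φ (generator i)) (toℕ j) -²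
        multiple (Φ (generator i)) (toℕ k) ∈ L → j ≡ k
      multiples-distinct i {j} {k} p = generator-order i (image-mod⁻¹ Λ-submodule
        (L.-²-trans {Φ (toℕ j times generator i)} {multiple (Φ (generator i)) (toℕ j)}
          (L.≈⇒-² (Φ-power L (toℕ j) (generator i)))
          (L.-²-trans {multiple (Φ (generator i)) (toℕ j)} {multiple (Φ (generator i)) (toℕ k)} p
            (L.≈⇒-² (C².≈ᴹ-sym (Φ-power L (toℕ k) (generator i)))))))

      L′-isAbelianSurface : ∀ i → IsAbelianSurface (L′ i)
      L′-isAbelianSurface i = enlarge (L′-subgroup i) (image-⊆ (Λ⊆overlattice i)) torsionFree surface
        where
        ℓL′⊆L : ∀ {z} → z ∈ L′ i → ℓ •² z ∈ L
        ℓL′⊆L (x , x∈ , eq) = ℓ times x , ℓM⊆Λ (overlattice⊆M i x∈)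
          , C².≈ᴹ-trans (Φ-times ℓ x) (•²-cong ℓ eq)
        open Enlarge {L} {L′ i} ℓ ℓL′⊆L
        torsionFree : ∀ {z} → z ∈ L′ i → ℓ •² z C².≈ᴹ C².0ᴹ → z C².≈ᴹ C².0ᴹ
        torsionFree (x , _ , eq) ℓz≈0 = C².≈ᴹ-trans (C².≈ᴹ-sym eq)
          (C².≈ᴹ-trans (Φ-cong (times-torsionFree ℓ (Φ≈0⇒≈0
            (C².≈ᴹ-trans (Φ-times ℓ x) (C².≈ᴹ-trans (•²-cong ℓ eq) ℓz≈0))))) Φ-0#)

      cyclic : ∀ i → IsCyclicIsogeny L M (L′ i) (λ z → z)
      cyclic i = record
        { codomain-isAbelianSurface = L′-isAbelianSurface i
        ; isIsogeny                 = identity-isIsogeny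
        ; kernel-isCyclic           = kernel-isNontrivialCyclic
        }
        where
        Φgenerator∉L : Φ (generator i) ∉ L
        Φgenerator∉L p = generator∉Λ i (image⁻¹ Λ-submodule p)
        open Quotient {L} {L′ i} {M} L-subgroup (L′-subgroup i) (image-⊆ (Λ⊆overlattice i))
          (image-⊆ (overlattice⊆M i)) (Φ (generator i)) (image (generator∈ i)) Φgenerator∉L
          ℓ (multiples-span i) (multiples-distinct i)

      I : Index → CyclicIsogeny L M
      I i = mkCyclicIsogeny (L′ i) (λ z → z) (cyclic i)

      L′-cong : ∀ {i j} → i ≈-index j → L′ i ≐ L′ j
      L′-cong i≈j = image-⊆ (overlattice-cong i≈j) , image-⊆ (overlattice-cong (index-sym i≈j))

      L′-injective : ∀ {i j} → L′ i ⊆ L′ j → i ≈-index j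
      L′-injective {i} {j} L′⊆ =
        overlattice-injective (λ x∈ → image⁻¹ (overlattice-submodule j) (L′⊆ (image x∈)))

      -- A generator of H is, up to a multiple, one of the generators of the
      -- lattices L′ i modulo L.
      cyclic⇒kernel : ∀ {H} → IsNontrivialCyclicSubgroup L M H → ∃[ i ] H ≐ L′ i
      cyclic⇒kernel {H} H-cyclic
        with g , g∈H , generates ← IsNontrivialCyclicSubgroup.cyclic H-cyclic
        with x , x∈M , Φx≈g ← IsNontrivialCyclicSubgroup.contained H-cyclic g∈H =
        choose (classify x∈M)
        where
        module H = IsSubgroup (IsNontrivialCyclicSubgroup.isSubgroup H-cyclic)

        multiple∈H : ∀ {z} → z ∈ H → ∀ n → multiple z n ∈ H
        multiple∈H z∈H zero    = H.ε-closed
        multiple∈H z∈H (suc n) = H.∙-closed z∈H (multiple∈H z∈H n)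

        -- H consists of multiples of Φ x modulo L, so x ∈ Λ would make it trivial.
        trivial : x ∉ Λ
        trivial x∈Λ with z , z∈H , z∉L ← IsNontrivialCyclicSubgroup.nontrivial H-cyclic =
          case generates z∈H of λ (k , p) →
            z∉L (L.∈⇒-²0 (L.absorb p (L.power-closed {L} (x , x∈Λ , Φx≈g) k)))

        H⊆ : ∀ i → x ∈ overlattice i → H ⊆ L′ i
        H⊆ i x∈ z∈H = case generates z∈H of λ (k , p) →
          L′.absorb i (image-⊆ (Λ⊆overlattice i) p) (L′.power-closed i {L} (x , x∈ , Φx≈g) k)

        ⊆H : ∀ i k → generator i ≡ k times x [mod Λ ] → L′ i ⊆ H
        ⊆H i k eq z∈ = case multiples-span i z∈ of λ (j , p) →
          H.respects (L.-²-sym p) (multiple∈H generator∈H (toℕ j))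
          where
          Φx∈H : Φ x ∈ H
          Φx∈H = H.respects (L.≈⇒-² (C².≈ᴹ-sym Φx≈g)) g∈H
          generator∈H : Φ (generator i) ∈ H
          generator∈H = H.respects
            (L.-²-sym (L.-²-trans {Φ (generator i)} {Φ (k times x)} (image-mod eq)
              (L.≈⇒-² (Φ-power L k x))))
            (multiple∈H Φx∈H k)

        choose : x ∈ Λ ⊎ (∃[ i ] (x ∈ overlattice i × ∃[ k ] generator i ≡ k times x [mod Λ ])) →
          ∃[ i ] H ≐ L′ i
        choose (inj₁ x∈Λ)               = ⊥-elim (trivial x∈Λ)
        choose (inj₂ (i , x∈ , k , eq)) = i , H⊆ i x∈ , ⊆H i k eq

      kernels-bijective : BijectiveOnClasses _≈-index_ (_≈-subgroup_ L M) (λ i → kernel L M (I i))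
      kernels-bijective = cong , injective , surjective
        where
        cong : ∀ {i j} → i ≈-index j → Kernel L (L′ i) (λ z → z) ≐ Kernel L (L′ j) (λ z → z)
        cong i≈j = (λ p → proj₁ (L′-cong i≈j) p) , (λ p → proj₂ (L′-cong i≈j) p)
        injective : ∀ {i j} → Kernel L (L′ i) (λ z → z) ≐ Kernel L (L′ j) (λ z → z) → i ≈-index j
        injective {i} {j} (K⊆ , _) = L′-injective (λ p → L′.-²0⇒∈ j (K⊆ (L′.∈⇒-²0 i p)))
        surjective : ∀ (H : NontrivialCyclicSubgroup L M) → ∃[ i ] (∀ {j} → j ≈-index i →
          Kernel L (L′ j) (λ z → z) ≐ proj₁ H)
        surjective (H , H-cyclic) = let i , H⊆ , ⊆H = cyclic⇒kernel H-cyclic in i , λ j≈i →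
            (λ p → ⊆H (L′.-²0⇒∈ i (proj₁ (cong j≈i) p)))
          , (λ p → proj₂ (cong j≈i) (L′.∈⇒-²0 i (H⊆ p)))

      isogenies-bijective : BijectiveOnClasses _≈-index_ (_≅-isogeny_ L M) I
      isogenies-bijective = cong , injective , surjective
        where
        cong : ∀ {i j} → i ≈-index j → _≅-isogeny_ L M (I i) (I j)
        cong {i} {j} i≈j = (λ z → z) , record
            { isTorusHomomorphism = record { isLinear = identity-isLinear ; mapsLattice = proj₁ L′≐ }
            ; bijective           = proj₂ L′≐ , λ z → z , λ p → proj₁ L′≐ p
            }
          , λ z → L′.≈⇒-² j C².≈ᴹ-refl
          where L′≐ = L′-cong i≈j

        -- h commutes with the projections from ℂ²/L, so it preserves their kernels.
        injective : ∀ {i j} → _≅-isogeny_ L M (I i) (I j) → i ≈-index j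
        injective {i} {j} (h , h-iso , commutes) = L′-injective λ {z} z∈ →
          L′.absorb j (L′.-²-sym j (commutes z))
            (IsTorusHomomorphism.mapsLattice (IsTorusIsomorphism.isTorusHomomorphism h-iso) z∈)

        -- Two isogenies with the same kernel: the linear map of the second one
        -- induces an isomorphism of the codomains.
        surjective : ∀ (f : CyclicIsogeny L M) → ∃[ i ] (∀ {j} → j ≈-index i → _≅-isogeny_ L M (I j) f)
        surjective f = let i , K⊆ , ⊆K = cyclic⇒kernel (IsCyclicIsogeny.kernel-isCyclic f-isogeny) in
          i , λ {j} j≈i → compare j (λ p → proj₂ (L′-cong j≈i) (K⊆ p))
                                    (λ p → ⊆K (proj₁ (L′-cong j≈i) p))
          where
          open CyclicIsogeny f using (map) renaming (codomain to N; isCyclicIsogeny to f-isogeny)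
          open IsIsogeny (IsCyclicIsogeny.isIsogeny f-isogeny)
          open IsTorusHomomorphism isTorusHomomorphism using (isLinear)
          open ModuleMorphisms.IsModuleHomomorphism isLinear using (+ᴹ-homo; -ᴹ-homo)
          module N = Subgroup (IsAbelianSurface.isSubgroup (IsCyclicIsogeny.codomain-isAbelianSurface f-isogeny))

          map-sub : ∀ z w → map (z -² w) C².≈ᴹ map z -² map w
          map-sub z w = C².≈ᴹ-trans (+ᴹ-homo z (C².-ᴹ w)) (C².+ᴹ-congˡ {map z} (-ᴹ-homo w))

          compare : ∀ j → Kernel L N map ⊆ L′ j → L′ j ⊆ Kernel L N map → _≅-isogeny_ L M (I j) f
          compare j K⊆ ⊆K = map , record
              { isTorusHomomorphism = record
                { isLinear = isLinear ; mapsLattice = λ p → N.-²0⇒∈ (⊆K p) }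
              ; bijective           =
                  (λ {z} {w} p → K⊆ (N.∈⇒-²0 (N.respects (C².≈ᴹ-sym (map-sub z w)) p)))
                -- The preimage x of y under f also serves modulo the larger lattice `L′ j`: a z
                -- congruent to x there has the same image, because `L′ j` lies in the kernel of f.
                , λ y → let x , onto = surjective′ y in x , λ {z} p → N.-²-trans {map z} {map x}
                    (N.respects (map-sub z x) (N.-²0⇒∈ (⊆K p))) (onto (L.≈⇒-² C².≈ᴹ-refl))
              }
            , λ z → N.≈⇒-² C².≈ᴹ-refl
            where surjective′ = IsIsogeny.surjective (IsCyclicIsogeny.isIsogeny f-isogeny)

proposition12 :
  (E : QuarticCMField) →
  let open QuarticCMField E in
  Primitive →
  K₀-HasClassNumber 1 →
  (type : CMType) →
  let open CMType type in
  (ℓ : ℕ) → Prime ℓ →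
  (𝔩 : Subset) → IsPrimeIdeal 𝔩 → HasNorm 𝔩 ℓ →
  (Λ₁ Λ₂ : Subset) → IsFractionalIdeal Λ₁ → IsFractionalIdeal Λ₂ →
  (τ : Carrier) → τ ∉ K₀ →
  let Λ  = Λ₁ ⊕ τ • Λ₂
      L  = Φ[ Λ ]
      M  = Φ[ 𝔩 ⁻¹ · Λ ]
      open Isogenies 𝔩 Λ₁ Λ₂ τ
  in
  IsAbelianSurface L →
  (𝒪 : Subset) → IsOrder 𝒪 → 𝒪₀ ⊆ 𝒪 → HasComplexMultiplication type 𝒪 L →
  Σ[ cyclic ∈ (∀ i → IsCyclicIsogeny L M Φ[ overlattice i ] (λ z → z)) ]
    (let I : Index → CyclicIsogeny L M
         I i = mkCyclicIsogeny Φ[ overlattice i ] (λ z → z) (cyclic i)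
     in BijectiveOnClasses _≈-index_ (_≈-subgroup_ L M) (λ i → kernel L M (I i))
      × BijectiveOnClasses _≈-index_ (_≅-isogeny_ L M) I)
proposition12 E _ classNumber1 type ℓ ℓ-prime 𝔩 𝔩-prime norm Λ₁ Λ₂ Λ₁-ideal Λ₂-ideal τ τ∉K₀
    surface 𝒪 𝒪-order 𝒪₀⊆𝒪 _ =
  Kernels.cyclic , Kernels.kernels-bijective , Kernels.isogenies-bijective
  where
  open Orders E
  𝒪₀-subring = 𝒪₀-isSubring 𝒪-order 𝒪₀⊆𝒪
  open Principal 𝒪₀-subring using (principal)
  module Plane = Lattices.Coordinates E 𝒪₀-subring ℓ ℓ-prime 𝔩 𝔩-prime norm
    Λ₁ Λ₂ Λ₁-ideal Λ₂-ideal τ τ∉K₀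
    (principal classNumber1 (QuarticCMField.IsPrimeIdeal.isFractionalIdeal 𝔩-prime))
    (principal classNumber1 Λ₁-ideal) (principal classNumber1 Λ₂-ideal)
  module Kernels = Plane.Tori type surface
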